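{- Let $G$ be a finite Abelian group of order $n$. If the Sylow 2-subgroups of $G$ are cyclic and nontrivial, then $\chi(G)\leq n+2$.
   Context: A latin square of order $n$ is an $n\times n$ array in which each row and each column is a permutation of a set of $n$ symbols. A partial transversal of a latin square is a set of cells containing at most one cell from each row, at most one cell from each column, and at most one cell containing each symbol. The chromatic number $\chi(L)$ of a latin square $L$ is the minimum number of partial transversals needed to partition the cells of $L$. For a finite group $G=\{g_0,\dots,g_{n-1}\}$, its Cayley table $L(G)$ is the latin square whose $(i,j)$ entry is $g_ig_j$; $\chi(G)$ denotes $\chi(L(G))$. -}

module Defs where

open import Data.Nat using (ℕ; zero; suc; _+_; _^_; _<_)
open import Data.Nat.Divisibility using (_∣_)
open import Data.Fin using (Fin)
open import Data.Fin.Subset using (Subset; _∈_; ∣_∣)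
open import Data.Product using (Σ; ∃; _×_; _,_)
open import Relation.Binary.PropositionalEquality using (_≡_; _≢_)
open import Relation.Nullary using (¬_)
open import Algebra.Structures using (IsAbelianGroup)

-- A finite abelian group of order n, with elements g₀,…,g_{n-1}
-- labelled by Fin n (every finite group of order n is of this form).

record FiniteAbelianGroup (n : ℕ) : Set where
  field
    _∙_ : Fin n → Fin n → Fin n
    ε   : Fin n
    _⁻¹ : Fin n → Fin n
    isAbelianGroup : IsAbelianGroup _≡_ _∙_ ε _⁻¹

  pow : Fin n → ℕ → Fin n
  pow g zero    = ε
  pow g (suc k) = g ∙ pow g k

  IsSubgroup : Subset n → Set
  IsSubgroup H = (ε ∈ H)
               × (∀ {x y} → x ∈ H → y ∈ H → (x ∙ y) ∈ H)
               × (∀ {x} → x ∈ H → (x ⁻¹) ∈ H)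

  IsSylow : ℕ → Subset n → Set
  IsSylow p P = IsSubgroup P
              × Σ ℕ (λ a → (∣ P ∣ ≡ p ^ a) × (p ^ a ∣ n) × ¬ (p ^ suc a ∣ n))

  IsCyclic : Subset n → Set
  IsCyclic H = Σ (Fin n) λ g → (g ∈ H) × (∀ {h} → h ∈ H → Σ ℕ λ k → h ≡ pow g k)

  IsNontrivial : Subset n → Set
  IsNontrivial H = 1 < ∣ H ∣

LatinSquare : ℕ → Set
LatinSquare n = Fin n → Fin n → Fin n

cayley : ∀ {n} → FiniteAbelianGroup n → LatinSquare n
cayley G i j = FiniteAbelianGroup._∙_ G i j

IsPartialTransversal : ∀ {n} → LatinSquare n → (Fin n → Fin n → Set) → Set
IsPartialTransversal {n} L T =
  ∀ {i j i' j'} → T i j → T i' j' →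
    ((i ≡ i' → j ≡ j') × (j ≡ j' → i ≡ i') × (L i j ≡ L i' j' → (i ≡ i' × j ≡ j')))

-- A partition of the cells of L into m partial transversals: each cell
-- gets a class in Fin m, and each class is a partial transversal.
-- (Empty classes are allowed; they do not affect the minimum.)
PartitionIntoPT : ∀ {n} → LatinSquare n → ℕ → Set
PartitionIntoPT {n} L m =
  Σ (Fin n → Fin n → Fin m) λ c →
    ∀ (k : Fin m) → IsPartialTransversal L (λ i j → c i j ≡ k)

-- χ(L) ≤ m : the minimum number of partial transversals partitioning the
-- cells of L is at most m, i.e. some partition into at most m of them exists.
χ≤ : ∀ {n} → LatinSquare n → ℕ → Set
χ≤ L m = PartitionIntoPT L m

{-# OPTIONS --safe #-}
module Submission where

open import Defs
open import Data.Nat using (ℕ; _+_)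
open import Data.Fin.Subset using (Subset)
open import Data.Product using (_×_)
open import Algebra.Bundles using (AbelianGroup)
open import Data.Bool using (Bool; true; false; not; _xor_; if_then_else_)
import Data.Bool.Properties as Bool
open import Data.Fin using (Fin; zero; suc; toℕ; fromℕ<)
import Data.Fin as Fin
import Data.Fin.Properties as Fin
open import Data.Fin.Subset using (∣_∣)
import Data.Fin.Subset as Subset
open import Data.List using ([]; _∷_)
open import Data.List.Relation.Unary.All using (_∷_)
open import Data.Nat using (zero; suc; _*_; _∸_; _^_; _≤_; _<_; z≤n; s≤s; NonZero; _/_; _%_; >-nonZero; >-nonZero⁻¹; nonTrivial⇒n>1)
open import Data.Nat.Coprimality using (Coprime; coprime-Bézout; coprime-divisor)
open import Data.Nat.Divisibility using (_∣_; _∤_; _∣?_; divides; ∣⇒≤; m∣m*n; ∣m+n∣m⇒∣n; m%n≡0⇒n∣m)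
open import Data.Nat.DivMod
open import Data.Nat.GCD using (module Bézout)
open import Data.Nat.Induction using (Acc; acc; <-wellFounded)
open import Data.Nat.ListAction using (product)
open import Data.Nat.Primality using (Prime; prime[2]; prime⇒irreducible; prime⇒nonZero; prime⇒nonTrivial)
open import Data.Nat.Primality.Factorisation using (factorise)
open import Data.Nat.Properties
open import Data.Nat.Tactic.RingSolver using (solve-∀)
open import Data.Product using (∃; _,_; proj₁; proj₂)
open import Data.Sum using (_⊎_; inj₁; inj₂; [_,_]′)
open import Data.Sum.Properties using (inj₁-injective; inj₂-injective)
open import Data.Vec using (_∷_; tabulate; here; there)
open import Data.Vec.Properties using (lookup∘tabulate; []=⇒lookup; lookup⇒[]=)
open import Function using (_∘_; case_of_)
open import Relation.Binary.PropositionalEquality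
open import Relation.Nullary using (¬_; Dec; yes; no; does; contradiction)
open import Relation.Nullary.Decidable using (map′; _×-dec_; _⊎-dec_; ¬?; dec-true; decidable-stable)

-- Write G additively. Passing to a Sylow 2-subgroup, the hypothesis says that G has exactly one
-- involution t. A subgroup Z of odd order is enlarged by sections isomorphic to (ℤ/p)², p odd,
-- until G/Z is cyclic; its generator g has even order 2μ modulo Z. Along the way Z acquires a cyclic
-- listing with distinct consecutive sums and a permutation θ for which θ − 1, θ and θ + 1
-- are permutations too.
--
-- The listing of Z extends to a cyclic listing of G, with successor N, that moves by t in half
-- a turn; x + N x is never a double and determines x up to t, as x + x does. For f ∈ 2G
-- consider the diagonal {(x , x + f)} and the near-diagonal {(N x , x + f)}: together, these sets
-- partition all cells. Cutting the cycle at s and s + t splits the two sets of f into half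
-- diagonals; a half of the first and the complementary half of the second have distinct rows,
-- columns and symbols except for one column that is hit twice. Removing one of the two offending
-- cells leaves n partial transversals, and the removed cells form a set and its translate by
-- (t , t). The cut points s are chosen, by means of θ on Z and explicitly on G/Z, so that this set
-- is a partial transversal as well.

-- The elements of G add up to t. Summing row + column - symbol over a transversal would give t = 0,
-- so L(G) has no transversal and every class has at most n - 1 cells; as n + 1 such classes miss a
-- cell, n + 2 is the right target. Here n classes have n - 1 cells and two have n/2.
--
-- Within a diagonal or near-diagonal, only the cells of x and x + t share a symbol; a half turn
-- separates them, hence the halves.
--
-- The split into Z and G/Z serves the choice of cuts. For f = 2a in 2Z and the cut (θ - 1)a, the
-- removed diagonal cell has row (θ - 1)a, column (θ + 1)a and symbol 2θa: this is where the three
-- permutations come from. On (ℤ/p)² a linear θ exists for every odd p, but on ℤ/3 there is none, so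
-- cyclic factors cannot all go into Z. In the cyclic quotient the cut j for f = 2j gives row j,
-- column 3j and symbol 4j, which works until 4j reaches 2μ; from there on the near-diagonal cell is
-- removed instead, whose symbol is odd.

-- Congruences, parity and digits in ℕ

infix 4 _≡_[mod_]

-- Multiples added on both sides replace subtraction, which ℕ truncates; M = 0 gives equality.
record _≡_[mod_] (a b M : ℕ) : Set where
  constructor cong-by
  field
    u v : ℕ
    eq  : a + u * M ≡ b + v * M

mod-refl : ∀ {M a b} → a ≡ b → a ≡ b [mod M ]
mod-refl refl = cong-by 0 0 refl

mod-sym : ∀ {M a b} → a ≡ b [mod M ] → b ≡ a [mod M ]
mod-sym (cong-by u v eq) = cong-by v u (sym eq)

module _ {M : ℕ} where
  open ≡-Reasoning

  mod-trans : ∀ {a b c} → a ≡ b [mod M ] → b ≡ c [mod M ] → a ≡ c [mod M ]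
  mod-trans {a} {b} {c} (cong-by u v p) (cong-by u′ v′ q) = cong-by (u + u′) (v + v′) (begin
    a + (u + u′) * M         ≡⟨ lem a u u′ M ⟩
    (a + u * M) + u′ * M     ≡⟨ cong (_+ u′ * M) p ⟩
    (b + v * M) + u′ * M     ≡⟨ lem₂ b v u′ M ⟩
    (b + u′ * M) + v * M     ≡⟨ cong (_+ v * M) q ⟩
    (c + v′ * M) + v * M     ≡⟨ lem₃ c v v′ M ⟩
    c + (v + v′) * M         ∎)
    where
    lem : ∀ a u u′ M → a + (u + u′) * M ≡ (a + u * M) + u′ * M
    lem = solve-∀
    lem₂ : ∀ b v u′ M → (b + v * M) + u′ * M ≡ (b + u′ * M) + v * M
    lem₂ = solve-∀
    lem₃ : ∀ c v v′ M → (c + v′ * M) + v * M ≡ c + (v + v′) * M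
    lem₃ = solve-∀

  mod-+ : ∀ {a b c d} → a ≡ b [mod M ] → c ≡ d [mod M ] → a + c ≡ b + d [mod M ]
  mod-+ {a} {b} {c} {d} (cong-by u v p) (cong-by u′ v′ q) =
    cong-by (u + u′) (v + v′) (trans (lem a c u u′ M) (trans (cong₂ _+_ p q) (sym (lem b d v v′ M))))
    where
    lem : ∀ a c u u′ M → a + c + (u + u′) * M ≡ (a + u * M) + (c + u′ * M)
    lem = solve-∀

  mod-* : ∀ k {a b} → a ≡ b [mod M ] → k * a ≡ k * b [mod M ]
  mod-* k {a} {b} (cong-by u v p) =
    cong-by (k * u) (k * v) (trans (lem k a u M) (trans (cong (k *_) p) (sym (lem k b v M))))
    where
    lem : ∀ k a u M → k * a + k * u * M ≡ k * (a + u * M)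
    lem = solve-∀

  mod-cancelˡ : ∀ c {a b} → c + a ≡ c + b [mod M ] → a ≡ b [mod M ]
  mod-cancelˡ c {a} {b} (cong-by u v p) = cong-by u v
    (+-cancelˡ-≡ c _ _ (trans (sym (+-assoc c a (u * M))) (trans p (+-assoc c b (v * M)))))

  mod-cancelʳ : ∀ c {a b} → a + c ≡ b + c [mod M ] → a ≡ b [mod M ]
  mod-cancelʳ c {a} {b} p = mod-cancelˡ c (subst₂ (λ x y → x ≡ y [mod M ]) (+-comm a c) (+-comm b c) p)

  mod-+ˡ : ∀ c {a b} → a ≡ b [mod M ] → c + a ≡ c + b [mod M ]
  mod-+ˡ c = mod-+ (mod-refl refl)

  mod-multiple : ∀ a q → a + q * M ≡ a [mod M ]
  mod-multiple a q = cong-by 0 q (+-identityʳ _)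

  mod-% : ∀ a .{{_ : NonZero M}} → a % M ≡ a [mod M ]
  mod-% a = cong-by (a / M) 0 (trans (sym (m≡m%n+[m/n]*n a M)) (sym (+-identityʳ a)))

  mod-≤ : ∀ {a b} .{{_ : NonZero M}} → a ≤ b → a ≡ b [mod M ] → ∃ λ q → b ≡ a + q * M
  mod-≤ {a} {b} a≤b (cong-by u v p) = u ∸ v , (begin
    b                            ≡⟨ sym (m+n∸n≡m b (v * M)) ⟩
    (b + v * M) ∸ v * M          ≡⟨ cong (_∸ v * M) (sym p) ⟩
    (a + u * M) ∸ v * M          ≡⟨ +-∸-assoc a (*-monoˡ-≤ M v≤u) ⟩
    a + (u * M ∸ v * M)          ≡⟨ cong (a +_) (sym (*-distribʳ-∸ M u v)) ⟩
    a + (u ∸ v) * M              ∎)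
    where
    v≤u : v ≤ u
    v≤u = *-cancelʳ-≤ v u M (+-cancelˡ-≤ a _ _ (≤-trans (+-monoˡ-≤ (v * M) a≤b) (≤-reflexive (sym p))))

  mod-unique-≤ : ∀ {a b} .{{_ : NonZero M}} → a ≤ b → b < a + M → a ≡ b [mod M ] → a ≡ b
  mod-unique-≤ {a} {b} a≤b b<a+M p with mod-≤ a≤b p
  ... | zero  , e = sym (trans e (+-identityʳ a))
  ... | suc q , e = contradiction b<a+M (≤⇒≯ (≤-trans (+-monoʳ-≤ a (m≤m+n M (q * M))) (≤-reflexive (sym e))))

  mod-unique : ∀ {a b} .{{_ : NonZero M}} → a < M → b < M → a ≡ b [mod M ] → a ≡ b
  mod-unique {a} {b} a<M b<M p with ≤-total a b
  ... | inj₁ a≤b = mod-unique-≤ a≤b (<-≤-trans b<M (m≤n+m M a)) p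
  ... | inj₂ b≤a = sym (mod-unique-≤ b≤a (<-≤-trans a<M (m≤n+m M b)) (mod-sym p))

  mod-%-unique : ∀ {a b} .{{_ : NonZero M}} → a ≡ b [mod M ] → a % M ≡ b % M
  mod-%-unique {a} {b} p = mod-unique (m%n<n a M) (m%n<n b M) (mod-trans (mod-% a) (mod-trans p (mod-sym (mod-% b))))

all≡[mod1] : ∀ i i′ → i ≡ i′ [mod 1 ]
all≡[mod1] i i′ = cong-by i′ i (lem i i′)
  where
  lem : ∀ i i′ → i + i′ * 1 ≡ i′ + i * 1
  lem = solve-∀

Odd : ℕ → Set
Odd N = ∃ λ w → N ≡ 1 + 2 * w

odd-* : ∀ {a b} → Odd a → Odd b → Odd (a * b)
odd-* (v , refl) (w , refl) = v + w + 2 * (v * w) , lem v w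
  where
  lem : ∀ v w → (1 + 2 * v) * (1 + 2 * w) ≡ 1 + 2 * (v + w + 2 * (v * w))
  lem = solve-∀

parity : ∀ n → (∃ λ w → n ≡ 2 * w) ⊎ Odd n
parity zero = inj₁ (0 , refl)
parity (suc n) with parity n
... | inj₁ (w , e) = inj₂ (w , cong suc e)
... | inj₂ (w , e) = inj₁ (suc w , trans (cong suc e) (lem w))
  where
  lem : ∀ w → 1 + (1 + 2 * w) ≡ 2 * (1 + w)
  lem = solve-∀

odd≢even : ∀ v w → 1 + 2 * v ≢ 2 * w
odd≢even zero    (suc w) e = contradiction (trans e (cong suc (+-suc w (w + 0)))) λ ()
odd≢even (suc v) (suc w) e = odd≢even v w (+-cancelˡ-≡ 2 _ _ (trans (sym (lem v)) (trans e (lem′ w))))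
  where
  lem : ∀ v → 1 + 2 * (1 + v) ≡ 2 + (1 + 2 * v)
  lem = solve-∀
  lem′ : ∀ w → 2 * (1 + w) ≡ 2 + 2 * w
  lem′ = solve-∀

-- For M = 1 + 2w, the number 1 + w is the inverse of 2.
mod-halve : ∀ {M a b} → Odd M → 2 * a ≡ 2 * b [mod M ] → a ≡ b [mod M ]
mod-halve {M} {a} {b} (w , refl) p = mod-trans (mod-sym (half a)) (mod-trans (mod-* (1 + w) p) (half b))
  where
  lem : ∀ w a → (1 + w) * (2 * a) ≡ a + a * (1 + 2 * w)
  lem = solve-∀
  half : ∀ a → (1 + w) * (2 * a) ≡ a [mod M ]
  half a = subst (_≡ a [mod M ]) (sym (lem w a)) (mod-multiple a a)

mod-scale : ∀ {M a b} k → a ≡ b [mod M ] → k * a ≡ k * b [mod k * M ]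
mod-scale {M} {a} {b} k (cong-by u v p) =
  cong-by u v (trans (lem k a u M) (trans (cong (k *_) p) (sym (lem k b v M))))
  where
  lem : ∀ k a u M → k * a + u * (k * M) ≡ k * (a + u * M)
  lem = solve-∀

mod-unscale : ∀ {M a b} k .{{_ : NonZero k}} → k * a ≡ k * b [mod k * M ] → a ≡ b [mod M ]
mod-unscale {M} {a} {b} k (cong-by u v p) =
  cong-by u v (*-cancelˡ-≡ _ _ k (trans (lem k a u M) (trans p (sym (lem k b v M)))))
  where
  lem : ∀ k a u M → k * (a + u * M) ≡ k * a + u * (k * M)
  lem = solve-∀

mod-digits : ∀ {N i i′} k .{{_ : NonZero k}} →
             i % k ≡ i′ % k → (i / k) ≡ (i′ / k) [mod N ] → i ≡ i′ [mod k * N ]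
mod-digits {N} {i} {i′} k r q =
  subst₂ (λ x y → x ≡ y [mod k * N ]) (digits i) (digits i′) (mod-+ (mod-refl r) (mod-scale k q))
  where
  digits : ∀ i → i % k + k * (i / k) ≡ i
  digits i = trans (cong (i % k +_) (*-comm k (i / k))) (sym (m≡m%n+[m/n]*n i k))

module _ (k : ℕ) .{{_ : NonZero k}} where
  %-digit : ∀ j q → j < k → (j + q * k) % k ≡ j
  %-digit j q j<k = trans ([m+kn]%n≡m%n j q k) (m<n⇒m%n≡m j<k)

  /-shift : ∀ i q → (i + q * k) / k ≡ i / k + q
  /-shift i q = trans (+-distrib-/-∣ʳ i (divides q refl)) (cong (i / k +_) (m*n/n≡m q k))

  /-digit : ∀ j q → j < k → (j + q * k) / k ≡ q
  /-digit j q j<k = trans (/-shift j q) (cong (_+ q) (m<n⇒m/n≡0 j<k))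

  suc-digits : ∀ i → (suc (i % k) < k × suc i % k ≡ suc (i % k) × suc i / k ≡ i / k)
                   ⊎ (suc (i % k) ≡ k × suc i % k ≡ 0 × suc i / k ≡ suc (i / k))
  suc-digits i with m≤n⇒m<n∨m≡n (m%n<n i k)
  ... | inj₁ lt = inj₁ (lt , trans (cong (_% k) i′) (%-digit (suc (i % k)) (i / k) lt)
                           , trans (cong (_/ k) i′) (/-digit (suc (i % k)) (i / k) lt))
    where
    i′ : suc i ≡ suc (i % k) + i / k * k
    i′ = cong suc (m≡m%n+[m/n]*n i k)
  ... | inj₂ eq = inj₂ (eq , trans (cong (_% k) i′) (m*n%n≡0 (suc (i / k)) k)
                           , trans (cong (_/ k) i′) (m*n/n≡m (suc (i / k)) k))
    where
    i′ : suc i ≡ suc (i / k) * k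
    i′ = trans (cong suc (m≡m%n+[m/n]*n i k)) (cong (_+ i / k * k) eq)

least : ∀ {P : ℕ → Set} → (∀ k → Dec (P k)) → ∀ b → P b → ∃ λ k → P k × (∀ j → j < k → ¬ P j)
least P? zero    p = zero , p , λ _ ()
least {P} P? (suc b) p with P? zero
... | yes p₀ = zero , p₀ , λ _ ()
... | no ¬p₀ with least (λ k → P? (suc k)) b p
...   | k , q , min = suc k , q , min′
  where
  min′ : ∀ j → j < suc k → ¬ P j
  min′ zero    _         = ¬p₀
  min′ (suc j) (s≤s j<k) = min j j<k

-- Subgroups as periodic listings, and orders modulo a subgroup

module Additive {n} (G : FiniteAbelianGroup n) where

  open FiniteAbelianGroup G public renaming (_∙_ to infixl 6 _⊕_; ε to 𝟘; _⁻¹ to ⊖_)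

  abelianGroup : AbelianGroup _ _
  abelianGroup = record { isAbelianGroup = isAbelianGroup }

  open AbelianGroup abelianGroup public using (commutativeMonoid; monoid; group)
    renaming (assoc to ⊕-assoc; comm to ⊕-comm; identityˡ to ⊕-identityˡ; identityʳ to ⊕-identityʳ; inverseʳ to ⊖-inverseʳ)
  open import Algebra.Definitions.RawMonoid (AbelianGroup.rawMonoid abelianGroup) public
    using () renaming (_×_ to infixr 8 _·_)
  open import Algebra.Properties.Monoid.Mult monoid public
    using () renaming (×-homo-+ to ·-+; ×-assocˡ to ·-·; ×-homo-1 to 1·)
  open import Algebra.Properties.CommutativeMonoid.Mult commutativeMonoid public
    using () renaming (×-distrib-+ to ·-⊕)
  open import Algebra.Properties.Group group public
    using () renaming (∙-cancelˡ to ⊕-cancelˡ; ∙-cancelʳ to ⊕-cancelʳ)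
  open import Algebra.Solver.CommutativeMonoid commutativeMonoid public
    using (solve; _⊜_) renaming (_⊕_ to _:⊕_; id to :𝟘)

  ·-𝟘 : ∀ k → k · 𝟘 ≡ 𝟘
  ·-𝟘 zero    = refl
  ·-𝟘 (suc k) = trans (⊕-identityˡ _) (·-𝟘 k)

  2· : ∀ x → 2 · x ≡ x ⊕ x
  2· x = cong (x ⊕_) (⊕-identityʳ x)

  odd· : ∀ w x → (1 + 2 * w) · x ≡ x ⊕ w · (2 · x)
  odd· w x = cong (x ⊕_) (trans (cong (_· x) (*-comm 2 w)) (sym (·-· x w 2)))

  odd·-involution : ∀ {N t} → Odd N → 2 · t ≡ 𝟘 → N · t ≡ t
  odd·-involution {t = t} (w , refl) 2t≡𝟘 =
    trans (odd· w t) (trans (cong (t ⊕_) (trans (cong (w ·_) 2t≡𝟘) (·-𝟘 w))) (⊕-identityʳ t))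

  ⊕-interchange : ∀ a b c d → (a ⊕ b) ⊕ (c ⊕ d) ≡ (a ⊕ c) ⊕ (b ⊕ d)
  ⊕-interchange = solve 4 (λ a b c d → ((a :⊕ b) :⊕ (c :⊕ d)) ⊜ ((a :⊕ c) :⊕ (b :⊕ d))) refl

  ⊕-swapʳ : ∀ a b c → (a ⊕ b) ⊕ c ≡ (a ⊕ c) ⊕ b
  ⊕-swapʳ = solve 3 (λ a b c → ((a :⊕ b) :⊕ c) ⊜ ((a :⊕ c) :⊕ b)) refl

  [x⊖y]⊕y : ∀ x y → (x ⊕ ⊖ y) ⊕ y ≡ x
  [x⊖y]⊕y x y = trans (⊕-swapʳ x (⊖ y) y)
    (trans (⊕-assoc x y (⊖ y)) (trans (cong (x ⊕_) (⊖-inverseʳ y)) (⊕-identityʳ x)))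

  multiple-𝟘 : ∀ x → ∃ λ k → 0 < k × k · x ≡ 𝟘
  multiple-𝟘 x with Fin.pigeonhole (n<1+n n) (λ i → toℕ i · x)
  ... | i , j , i<j , e = toℕ j ∸ toℕ i , m<n⇒0<n∸m i<j , ⊕-cancelˡ (toℕ i · x) _ _ (begin
      toℕ i · x ⊕ (toℕ j ∸ toℕ i) · x  ≡⟨ ·-+ x (toℕ i) (toℕ j ∸ toℕ i) ⟨
      (toℕ i + (toℕ j ∸ toℕ i)) · x    ≡⟨ cong (_· x) (m+[n∸m]≡n (<⇒≤ i<j)) ⟩
      toℕ j · x                        ≡⟨ e ⟨
      toℕ i · x                        ≡⟨ ⊕-identityʳ _ ⟨
      toℕ i · x ⊕ 𝟘                    ∎)
    where open ≡-Reasoning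

  -- A subgroup as a periodic sequence: indices live in ℕ and count modulo `size`, so the successor
  -- is cyclic without a special case at the end. `exponent` carries Lagrange's theorem along, and
  -- with it inverses as multiples.
  record Enumeration : Set where
    no-eta-equality
    field
      size          : ℕ
      {{size≢0}}    : NonZero size
      at            : ℕ → Fin n
      at-cong       : ∀ {i i′} → i ≡ i′ [mod size ] → at i ≡ at i′
      at-injective  : ∀ {i i′} → at i ≡ at i′ → i ≡ i′ [mod size ]
      at-0          : at 0 ≡ 𝟘
      at-⊕          : ∀ i j → ∃ λ k → at i ⊕ at j ≡ at k
      exponent      : ∀ i → size · at i ≡ 𝟘

    reduce : ℕ → Fin size
    reduce i = fromℕ< (m%n<n i size)

    at-reduce : ∀ i → at (toℕ (reduce i)) ≡ at i
    at-reduce i = trans (cong at (Fin.toℕ-fromℕ< (m%n<n i size))) (at-cong (mod-% i))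

    at-toℕ-injective : ∀ {i j : Fin size} → at (toℕ i) ≡ at (toℕ j) → i ≡ j
    at-toℕ-injective {i} {j} e = Fin.toℕ-injective (mod-unique (Fin.toℕ<n i) (Fin.toℕ<n j) (at-injective e))

    size≤n : size ≤ n
    size≤n = Fin.injective⇒≤ {f = λ i → at (toℕ i)} at-toℕ-injective

  open Enumeration public

  infix 4 _∈_ _∉_ _∈?_

  _∈_ _∉_ : Fin n → Enumeration → Set
  x ∈ E = ∃ λ i → x ≡ at E i
  x ∉ E = ¬ (x ∈ E)

  _∈?_ : ∀ x E → Dec (x ∈ E)
  x ∈? E = map′ (λ (i , e) → toℕ i , e) bound (Fin.any? λ i → x Fin.≟ at E (toℕ i))
    where
    bound : x ∈ E → ∃ λ i → x ≡ at E (toℕ i)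
    bound (i , e) = reduce E i , trans e (sym (at-reduce E i))

  module _ (E : Enumeration) where

    ∈-𝟘 : 𝟘 ∈ E
    ∈-𝟘 = 0 , sym (at-0 E)

    ∈-⊕ : ∀ {x y} → x ∈ E → y ∈ E → x ⊕ y ∈ E
    ∈-⊕ (i , refl) (j , refl) = at-⊕ E i j

    ∈-· : ∀ k {x} → x ∈ E → k · x ∈ E
    ∈-· zero    _ = ∈-𝟘
    ∈-· (suc k) p = ∈-⊕ p (∈-· k p)

    size·∈ : ∀ {x} → x ∈ E → size E · x ≡ 𝟘
    size·∈ (i , refl) = exponent E i

    -- The exponent gives the inverse without naming it.
    ∈-cancel : ∀ {x y} → y ∈ E → x ⊕ y ∈ E → x ∈ E
    ∈-cancel {x} {y} p q = subst (_∈ E) e (∈-⊕ q (∈-· (size E ∸ 1) p))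
      where
      open ≡-Reasoning
      e : (x ⊕ y) ⊕ (size E ∸ 1) · y ≡ x
      e = begin
        (x ⊕ y) ⊕ (size E ∸ 1) · y  ≡⟨ ⊕-assoc x y _ ⟩
        x ⊕ suc (size E ∸ 1) · y    ≡⟨ cong (λ k → x ⊕ k · y) (suc-pred (size E) {{size≢0 E}}) ⟩
        x ⊕ size E · y              ≡⟨ cong (x ⊕_) (size·∈ p) ⟩
        x ⊕ 𝟘                       ≡⟨ ⊕-identityʳ x ⟩
        x                           ∎

    ∈-⊖ : ∀ {x} → x ∈ E → ⊖ x ∈ E
    ∈-⊖ {x} p = ∈-cancel p (subst (_∈ E) (sym (trans (⊕-comm (⊖ x) x) (⊖-inverseʳ x))) ∈-𝟘)

    halve-∈ : Odd (size E) → ∀ {x} → x ∈ E → ∃ λ y → y ∈ E × 2 · y ≡ x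
    halve-∈ (w , odd) {x} p = (1 + w) · x , ∈-· (1 + w) p , (begin
      2 · (1 + w) · x       ≡⟨ ·-· x 2 (1 + w) ⟩
      (2 * (1 + w)) · x     ≡⟨ cong (_· x) (trans (*-suc 2 w) (cong suc (sym odd))) ⟩
      x ⊕ size E · x        ≡⟨ cong (x ⊕_) (size·∈ p) ⟩
      x ⊕ 𝟘                 ≡⟨ ⊕-identityʳ x ⟩
      x                     ∎)
      where open ≡-Reasoning

    2·-injective : Odd (size E) → ∀ {x y} → x ∈ E → y ∈ E → 2 · x ≡ 2 · y → x ≡ y
    2·-injective (w , odd) {x} {y} p q e = trans (sym (back p)) (trans (cong ((1 + w) ·_) e) (back q))
      where
      open ≡-Reasoning
      back : ∀ {x} → x ∈ E → (1 + w) · 2 · x ≡ x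
      back {x} p = begin
        (1 + w) · 2 · x       ≡⟨ ·-· x (1 + w) 2 ⟩
        ((1 + w) * 2) · x     ≡⟨ cong (_· x) (trans (*-comm (1 + w) 2) (trans (*-suc 2 w) (cong suc (sym odd)))) ⟩
        x ⊕ size E · x        ≡⟨ cong (x ⊕_) (size·∈ p) ⟩
        x ⊕ 𝟘                 ≡⟨ ⊕-identityʳ x ⟩
        x                     ∎

    infix 4 _∼_
    _∼_ : Fin n → Fin n → Set
    x ∼ y = ∃ λ h → h ∈ E × x ≡ y ⊕ h

    ∼-refl : ∀ {x y} → x ≡ y → x ∼ y
    ∼-refl {x} refl = 𝟘 , ∈-𝟘 , sym (⊕-identityʳ x)

    ∼-⊕∈ : ∀ {x h} → h ∈ E → x ⊕ h ∼ x
    ∼-⊕∈ {h = h} p = h , p , refl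

    ∼-sym : ∀ {x y} → x ∼ y → y ∼ x
    ∼-sym {x} {y} (h , p , refl) = ⊖ h , ∈-⊖ p ,
      sym (trans (⊕-swapʳ y h (⊖ h)) ([x⊖y]⊕y y h))

    ∼-trans : ∀ {x y z} → x ∼ y → y ∼ z → x ∼ z
    ∼-trans {z = z} (h , p , refl) (h′ , p′ , refl) = h′ ⊕ h , ∈-⊕ p′ p , ⊕-assoc z h′ h

    ∼-⊕ : ∀ {x y x′ y′} → x ∼ y → x′ ∼ y′ → x ⊕ x′ ∼ y ⊕ y′
    ∼-⊕ {y = y} {y′ = y′} (h , p , refl) (h′ , p′ , refl) = h ⊕ h′ , ∈-⊕ p p′ , ⊕-interchange y h y′ h′

    ∼-· : ∀ k {x y} → x ∼ y → k · x ∼ k · y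
    ∼-· k {y = y} (h , p , refl) = k · h , ∈-· k p , ·-⊕ y h k

    ∼-cancelˡ : ∀ z {x y} → z ⊕ x ∼ z ⊕ y → x ∼ y
    ∼-cancelˡ z {x} {y} (h , p , e) = h , p , ⊕-cancelˡ z _ _ (trans e (⊕-assoc z y h))

    ∼𝟘⇒∈ : ∀ {x} → x ∼ 𝟘 → x ∈ E
    ∼𝟘⇒∈ (h , p , refl) = subst (_∈ E) (sym (⊕-identityˡ h)) p

    ∈-resp-∼ : ∀ {x y} → x ∼ y → y ∈ E → x ∈ E
    ∈-resp-∼ (h , p , refl) q = ∈-⊕ q p

    -- The order of g in the quotient by E.
    record HasOrder (g : Fin n) (k : ℕ) : Set where
      no-eta-equality
      field
        order≢0 : NonZero k
        k·g∈    : k · g ∈ E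
        minimal : ∀ {d} → d · g ∈ E → k ∣ d

      difference : ∀ {i i′} → i ≤ i′ → i′ · g ∼ i · g → i′ ≡ i [mod k ]
      difference {i} {i′} i≤i′ p
        with minimal {i′ ∸ i} (∼𝟘⇒∈ (∼-cancelˡ (i · g) (∼-trans (∼-refl e) (∼-trans p (∼-refl (sym (⊕-identityʳ _)))))))
        where
        e : i · g ⊕ (i′ ∸ i) · g ≡ i′ · g
        e = trans (sym (·-+ g i (i′ ∸ i))) (cong (_· g) (m+[n∸m]≡n i≤i′))
      ... | divides q d = subst (λ j → j ≡ i [mod k ]) (trans (cong (i +_) (sym d)) (m+[n∸m]≡n i≤i′)) (mod-multiple i q)

      free : ∀ {i i′} → i · g ∼ i′ · g → i ≡ i′ [mod k ]
      free {i} {i′} p with ≤-total i i′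
      ... | inj₁ i≤i′ = mod-sym (difference i≤i′ (∼-sym p))
      ... | inj₂ i′≤i = difference i′≤i p

      cofree : ∀ {i i′} → i ≡ i′ [mod k ] → i · g ∼ i′ · g
      cofree {i} {i′} (cong-by u v e) =
        ∼-trans (∼-sym (shift i u)) (∼-trans (∼-refl (cong (_· g) e)) (shift i′ v))
        where
        shift : ∀ i u → (i + u * k) · g ∼ i · g
        shift i u = u · k · g , ∈-· u k·g∈ , trans (·-+ g i (u * k)) (cong (i · g ⊕_) (sym (·-· g u k)))

    open HasOrder public

    remainder∈ : ∀ {g k d} .{{_ : NonZero k}} → k · g ∈ E → d · g ∈ E → (d % k) · g ∈ E
    remainder∈ {g} {k} {d} kg∈ dg∈ = ∈-cancel (∈-· (d / k) kg∈) (subst (_∈ E) e dg∈)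
      where
      e : d · g ≡ (d % k) · g ⊕ (d / k) · k · g
      e = trans (cong (_· g) (m≡m%n+[m/n]*n d k))
            (trans (·-+ g (d % k) (d / k * k)) (cong ((d % k) · g ⊕_) (sym (·-· g (d / k) k))))

    least-order : ∀ {g k} {{_ : NonZero k}} → k · g ∈ E → (∀ j → j < k → ¬ (0 < j × j · g ∈ E)) → HasOrder g k
    least-order {g} {k} {{k≢0}} kg∈ min = record { order≢0 = k≢0 ; k·g∈ = kg∈ ; minimal = minimal′ }
      where
      minimal′ : ∀ {d} → d · g ∈ E → k ∣ d
      minimal′ {d} dg∈ with d % k ≟ 0
      ... | yes d%k≡0 = m%n≡0⇒n∣m d k d%k≡0
      ... | no  d%k≢0 = contradiction (n≢0⇒n>0 d%k≢0 , remainder∈ kg∈ dg∈) (min (d % k) (m%n<n d k))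

    abstract
      order : ∀ g → ∃ (HasOrder g)
      order g with multiple-𝟘 g
      ... | b , 0<b , bg≡𝟘 with least (λ k → (0 <? k) ×-dec (k · g ∈? E)) b (0<b , subst (_∈ E) (sym bg≡𝟘) ∈-𝟘)
      ...   | k , (0<k , kg∈) , min = k , least-order {{>-nonZero 0<k}} kg∈ min

  infix 4 _∼⟨_⟩_
  _∼⟨_⟩_ : Fin n → Enumeration → Fin n → Set
  x ∼⟨ E ⟩ y = _∼_ E x y

-- Extending a listing by one generator

module Extensions {n} (G : FiniteAbelianGroup n) where
  open Additive G

  trivial : Enumeration
  trivial .size = 1
  trivial .size≢0 = _
  trivial .at _ = 𝟘
  trivial .at-cong _ = refl
  trivial .at-injective {i} {i′} _ = all≡[mod1] i i′
  trivial .at-0 = refl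
  trivial .at-⊕ _ _ = 0 , ⊕-identityʳ 𝟘
  trivial .exponent _ = ⊕-identityʳ 𝟘

  ∈-trivial : ∀ {x} → x ∈ trivial → x ≡ 𝟘
  ∈-trivial (_ , e) = e

  -- Read cyclically, since `at` has period `size`; groups with such a listing are known as
  -- harmonious groups.
  Harmonious : Enumeration → Set
  Harmonious E = ∀ {i i′} → at E i ⊕ at E (suc i) ≡ at E i′ ⊕ at E (suc i′) → i ≡ i′ [mod size E ]

  module Extension (E : Enumeration) (g : Fin n) (k : ℕ) (o : HasOrder E g k) where

    instance
      k≢0 : NonZero k
      k≢0 = order≢0 o

    -- Mixed radix: the low digit counts copies of g, the quotient by k is a position in E. Since k
    -- · g lies in E, the coset of `at⁺ i` is that of i · g, whatever the carries.
    at⁺ : ℕ → Fin n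
    at⁺ i = (i % k) · g ⊕ at E (i / k)

    %∼ : ∀ i → (i % k) · g ∼⟨ E ⟩ i · g
    %∼ i = cofree o (mod-% i)

    at⁺∼ : ∀ i → at⁺ i ∼⟨ E ⟩ i · g
    at⁺∼ i = ∼-trans E (∼-⊕∈ E (i / k , refl)) (%∼ i)

    at⁺-mod-k : ∀ {i i′} → at⁺ i ∼⟨ E ⟩ at⁺ i′ → i ≡ i′ [mod k ]
    at⁺-mod-k {i} {i′} p = free o (∼-trans E (∼-sym E (at⁺∼ i)) (∼-trans E p (at⁺∼ i′)))

    at⁺-digits : ∀ j l → j < k → at⁺ (j + l * k) ≡ j · g ⊕ at E l
    at⁺-digits j l j<k = cong₂ (λ a b → a · g ⊕ at E b) (%-digit k j l j<k) (/-digit k j l j<k)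

    split : ∀ i {h} → h ∈ E → ∃ λ h′ → h′ ∈ E × i · g ⊕ h ≡ (i % k) · g ⊕ h′
    split i {h} h∈ = let h′ , h′∈ , e = ∼-sym E (%∼ i) in
      h′ ⊕ h , ∈-⊕ E h′∈ h∈ , trans (cong (_⊕ h) e) (⊕-assoc _ h′ h)

    reach : ∀ i {h} → h ∈ E → ∃ λ l → i · g ⊕ h ≡ at⁺ l
    reach i h∈ with split i h∈
    ... | h′ , (l , refl) , e = i % k + l * k , trans e (sym (at⁺-digits (i % k) l (m%n<n i k)))

    private
      0%n : ∀ k .{{_ : NonZero k}} → 0 % k ≡ 0
      0%n k = m<n⇒m%n≡m (>-nonZero⁻¹ k)
      weaken : ∀ {i i′} → i ≡ i′ [mod k * size E ] → i ≡ i′ [mod k ]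
      weaken {i} {i′} (cong-by u v e) = cong-by (u * size E) (v * size E)
        (trans (cong (i +_) (lem u (size E) k)) (trans e (cong (i′ +_) (sym (lem v (size E) k)))))
        where
        lem : ∀ u s k → u * s * k ≡ u * (k * s)
        lem = solve-∀
      %-eq : ∀ {i i′} → i ≡ i′ [mod k * size E ] → i % k ≡ i′ % k
      %-eq p = mod-%-unique (weaken p)
      /-eq : ∀ {i i′} → i ≡ i′ [mod k * size E ] → i / k ≡ i′ / k [mod size E ]
      /-eq {i} {i′} (cong-by u v e) = cong-by (u * 1) (v * 1) (trans (shift i u) (trans (cong (_/ k) e) (sym (shift i′ v))))
        where
        lem : ∀ u s k → u * (k * s) ≡ u * s * k
        lem = solve-∀
        shift : ∀ i u → i / k + u * 1 * size E ≡ (i + u * (k * size E)) / k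
        shift i u = trans (cong (λ z → i / k + z * size E) (*-identityʳ u))
          (sym (trans (cong (λ z → (i + z) / k) (lem u (size E) k)) (/-shift k i (u * size E))))
      inj : ∀ {i i′} → at⁺ i ≡ at⁺ i′ → i ≡ i′ [mod k * size E ]
      inj {i} {i′} e = mod-digits k same (at-injective E
          (⊕-cancelˡ ((i % k) · g) _ _ (trans e (cong (λ a → a · g ⊕ at E (i′ / k)) (sym same)))))
        where
        same : i % k ≡ i′ % k
        same = mod-%-unique (at⁺-mod-k (∼-refl E e))
      sums : ∀ i j → ∃ λ l → at⁺ i ⊕ at⁺ j ≡ at⁺ l
      sums i j with reach (i % k + j % k) (∈-⊕ E (i / k , refl) (j / k , refl))
      ... | l , e = l , trans (⊕-interchange _ _ _ _)
                          (trans (cong (_⊕ (at E (i / k) ⊕ at E (j / k))) (sym (·-+ g (i % k) (j % k)))) e)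
      exponent⁺ : ∀ i → (k * size E) · at⁺ i ≡ 𝟘
      exponent⁺ i = trans (cong (_· at⁺ i) (*-comm k (size E)))
        (trans (sym (·-· (at⁺ i) (size E) k)) (size·∈ E (∼𝟘⇒∈ E
          (∼-trans E (∼-· E k (at⁺∼ i)) (∼-trans E (∼-refl E (·-· g k i))
            (cofree o (cong-by 0 i (trans (+-identityʳ _) (*-comm k i)))))))))

    extend : Enumeration
    extend .size = k * size E
    extend .size≢0 = m*n≢0 k (size E) {{k≢0}} {{size≢0 E}}
    extend .at = at⁺
    extend .at-cong p = cong₂ (λ a b → a · g ⊕ b) (%-eq p) (at-cong E (/-eq p))
    extend .at-injective = inj
    extend .at-0 = trans (cong₂ (λ a b → a · g ⊕ at E b) (0%n k) (0/n≡0 k)) (trans (⊕-identityˡ _) (at-0 E))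
    extend .at-⊕ = sums
    extend .exponent = exponent⁺

    ∈-extend : ∀ i {h} → h ∈ E → i · g ⊕ h ∈ extend
    ∈-extend = reach

    ⊆-extend : ∀ {h} → h ∈ E → h ∈ extend
    ⊆-extend h∈ = subst (_∈ extend) (⊕-identityˡ _) (∈-extend 0 h∈)

    g∈extend : g ∈ extend
    g∈extend = subst (_∈ extend) (trans (⊕-identityʳ _) (⊕-identityʳ g)) (∈-extend 1 (∈-𝟘 E))

    split-extend : ∀ {x} → x ∈ extend → ∃ λ i → ∃ λ h → i < k × h ∈ E × x ≡ i · g ⊕ h
    split-extend (i , e) = i % k , at E (i / k) , m%n<n i k , (i / k , refl) , e

    -- A carry returns the lowest digit from k − 1 to 0, so it also adds g modulo E;
    -- k odd makes the digit 2i + 1 of a consecutive sum determine i.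
    extend-harmonious : Odd k → Odd (size E) → Harmonious E → Harmonious extend
    extend-harmonious odd-k odd-E harm {i} {i′} e = mod-digits k same rest
      where
      sum∼ : ∀ i → at⁺ i ⊕ at⁺ (suc i) ∼⟨ E ⟩ (1 + 2 * i) · g
      sum∼ i = ∼-trans E (∼-⊕ E (at⁺∼ i) (at⁺∼ (suc i)))
        (∼-refl E (trans (sym (·-+ g i (suc i))) (cong (_· g) (lem i))))
        where
        lem : ∀ i → i + suc i ≡ 1 + 2 * i
        lem = solve-∀
      same : i % k ≡ i′ % k
      same = mod-%-unique (mod-halve odd-k (mod-cancelˡ 1 (free o
        (∼-trans E (∼-sym E (sum∼ i)) (∼-trans E (∼-refl E e) (sum∼ i′))))))
      plain : ∀ i → suc i % k ≡ suc (i % k) → suc i / k ≡ i / k →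
              at⁺ i ⊕ at⁺ (suc i) ≡ ((i % k) · g ⊕ suc (i % k) · g) ⊕ 2 · at E (i / k)
      plain i p q = trans (cong (at⁺ i ⊕_) (cong₂ (λ a b → a · g ⊕ at E b) p q))
        (trans (⊕-interchange _ _ _ _) (cong (((i % k) · g ⊕ suc (i % k) · g) ⊕_) (sym (2· _))))
      carry : ∀ i → suc i % k ≡ 0 → suc i / k ≡ suc (i / k) →
              at⁺ i ⊕ at⁺ (suc i) ≡ ((i % k) · g ⊕ 𝟘) ⊕ (at E (i / k) ⊕ at E (suc (i / k)))
      carry i p q = trans (cong (at⁺ i ⊕_) (cong₂ (λ a b → a · g ⊕ at E b) p q)) (⊕-interchange _ _ _ _)
      rest : i / k ≡ i′ / k [mod size E ]
      rest with suc-digits k i | suc-digits k i′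
      ... | inj₁ (_ , p , q) | inj₁ (_ , p′ , q′) = at-injective E
        (2·-injective E odd-E (i / k , refl) (i′ / k , refl)
          (⊕-cancelˡ ((i % k) · g ⊕ suc (i % k) · g) _ _ (trans (sym (plain i p q)) (trans e (trans (plain i′ p′ q′)
            (cong (λ r → (r · g ⊕ suc r · g) ⊕ 2 · at E (i′ / k)) (sym same)))))))
      ... | inj₂ (_ , p , q) | inj₂ (_ , p′ , q′) = harm
        (⊕-cancelˡ ((i % k) · g ⊕ 𝟘) _ _ (trans (sym (carry i p q)) (trans e (trans (carry i′ p′ q′)
            (cong (λ r → (r · g ⊕ 𝟘) ⊕ (at E (i′ / k) ⊕ at E (suc (i′ / k)))) (sym same))))))
      ... | inj₁ (lt , _) | inj₂ (eq , _) = contradiction (trans (cong suc same) eq) (<⇒≢ lt)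
      ... | inj₂ (eq , _) | inj₁ (lt , _) = contradiction (trans (cong suc (sym same)) eq) (<⇒≢ lt)

  open Extension public using (extend; ∈-extend; ⊆-extend; g∈extend; split-extend; extend-harmonious)

  order>1 : ∀ {E g k} → HasOrder E g k → g ∉ E → 1 < k
  order>1 {E} {g} {zero} o g∉ with () ← NonZero.nonZero (order≢0 o)
  order>1 {E} {g} {suc zero} o g∉ = contradiction (subst (_∈ E) (⊕-identityʳ g) (k·g∈ o)) g∉
  order>1 {k = suc (suc k)} o g∉ = s≤s (s≤s z≤n)

  extend-grows : ∀ {E g k} (o : HasOrder E g k) → g ∉ E → size E < size (extend E g k o)
  extend-grows {E} {g} {k} o g∉ = subst (_< k * size E) (*-identityˡ (size E)) (*-monoˡ-< (size E) {{size≢0 E}} (order>1 o g∉))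

  abstract
    remaining : Enumeration → ℕ
    remaining E = n ∸ size E

    extend-remaining : ∀ {E g k} (o : HasOrder E g k) → g ∉ E → remaining (extend E g k o) < remaining E
    extend-remaining {E} {g} {k} o g∉ = ∸-monoʳ-< {n} (extend-grows {E} {g} {k} o g∉) (size≤n (extend E g k o))

-- From cyclic Sylow 2-subgroups to a unique involution

does-true : ∀ {P : Set} (P? : Dec P) → does P? ≡ true → P
does-true (yes p) _ = p

member : ∀ {n} (p : Subset n) → Fin ∣ p ∣ → Fin n
member (true  ∷ p) zero    = zero
member (true  ∷ p) (suc i) = suc (member p i)
member (false ∷ p) i       = suc (member p i)

member-∈ : ∀ {n} (p : Subset n) i → member p i Subset.∈ p
member-∈ (true  ∷ p) zero    = here
member-∈ (true  ∷ p) (suc i) = there (member-∈ p i)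
member-∈ (false ∷ p) i       = there (member-∈ p i)

member-injective : ∀ {n} (p : Subset n) {i j} → member p i ≡ member p j → i ≡ j
member-injective (true  ∷ p) {zero}  {zero}  _ = refl
member-injective (true  ∷ p) {suc i} {suc j} e = cong suc (member-injective p (Fin.suc-injective e))
member-injective (false ∷ p)                 e = member-injective p (Fin.suc-injective e)

member-surjective : ∀ {n} (p : Subset n) {x} → x Subset.∈ p → ∃ λ i → member p i ≡ x
member-surjective (true  ∷ p) here = zero , refl
member-surjective (true  ∷ p) (there x∈) with member-surjective p x∈
... | i , e = suc i , cong suc e
member-surjective (false ∷ p) (there x∈) with member-surjective p x∈
... | i , e = i , cong suc e

module Involutions {n} (G : FiniteAbelianGroup n) where
  open Additive G
  open Extensions G

  -- The quotient G/E has no involution, that is, E contains a full Sylow 2-subgroup.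
  TwoClosed : Enumeration → Set
  TwoClosed E = ∀ {x} → 2 · x ∈ E → x ∈ E

  module _ (E : Enumeration) where

    index : ∀ {x} → x ∈ E → Fin (size E)
    index (i , _) = reduce E i

    at-index : ∀ {x} (x∈ : x ∈ E) → at E (toℕ (index x∈)) ≡ x
    at-index (i , e) = trans (at-reduce E i) (sym e)

    index-injective : ∀ {x y} (x∈ : x ∈ E) (y∈ : y ∈ E) → index x∈ ≡ index y∈ → x ≡ y
    index-injective x∈ y∈ e = trans (sym (at-index x∈)) (trans (cong (at E ∘ toℕ) e) (at-index y∈))

    size-all : (∀ x → x ∈ E) → size E ≡ n
    size-all all = ≤-antisym (size≤n E) (Fin.injective⇒≤ {f = λ x → index (all x)} λ {x} {y} → index-injective (all x) (all y))

    elements : Subset n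
    elements = tabulate λ x → does (x ∈? E)

    ∈-elements : ∀ {x} → x ∈ E → x Subset.∈ elements
    ∈-elements {x} x∈ = lookup⇒[]= x elements (trans (lookup∘tabulate _ x) (dec-true (x ∈? E) x∈))

    elements-∈ : ∀ {x} → x Subset.∈ elements → x ∈ E
    elements-∈ {x} x∈ = does-true (x ∈? E) (trans (sym (lookup∘tabulate (λ x → does (x ∈? E)) x)) ([]=⇒lookup x∈))

    card-elements : ∣ elements ∣ ≡ size E
    card-elements = ≤-antisym
      (Fin.injective⇒≤ {f = λ i → index (elements-∈ (member-∈ elements i))}
        λ e → member-injective elements (index-injective (elements-∈ (member-∈ elements _)) (elements-∈ (member-∈ elements _)) e))
      (Fin.injective⇒≤ {f = proj₁ ∘ preimage} λ {i} {j} e → at-toℕ-injective E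
        (trans (sym (proj₂ (preimage i))) (trans (cong (member elements) e) (proj₂ (preimage j)))))
      where
      preimage : ∀ (i : Fin (size E)) → ∃ λ j → member elements j ≡ at E (toℕ i)
      preimage i = member-surjective elements (∈-elements (toℕ i , refl))

    all∈? : (∀ x → x ∈ E) ⊎ ∃ λ x → x ∉ E
    all∈? with Fin.all? (_∈? E)
    ... | yes all = inj₁ all
    ... | no ¬all = inj₂ (Fin.¬∀⟶∃¬ n (_∈ E) (_∈? E) ¬all)

    k·extend∈ : ∀ {g k} (o : HasOrder E g k) {x} → x ∈ extend E g k o → k · x ∈ E
    k·extend∈ {g} {k} o x∈ with split-extend E g k o x∈
    ... | i , h , _ , h∈ , refl = subst (_∈ E) (sym e) (∈-⊕ E (∈-· E i (k·g∈ o)) (∈-· E k h∈))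
      where
      e : k · (i · g ⊕ h) ≡ i · k · g ⊕ k · h
      e = trans (·-⊕ (i · g) h k) (cong (_⊕ k · h) (trans (·-· g k i) (trans (cong (_· g) (*-comm k i)) (sym (·-· g i k)))))

    module _ (closed : TwoClosed E) where

      order-odd : ∀ {g k} → HasOrder E g k → Odd k
      order-odd {g} {k} o with parity k
      ... | inj₂ odd = odd
      ... | inj₁ (zero  , refl) with () ← NonZero.nonZero (order≢0 o)
      ... | inj₁ (suc w , refl) = contradiction (∣⇒≤ (minimal o (closed (subst (_∈ E) (sym (·-· g 2 (suc w))) (k·g∈ o)))))
                                                (<⇒≱ (m<m+n (suc w) (s≤s z≤n)))

      -- With k = 1 + 2w, x = k · x - w · 2 · x. The first term lies in E because its double k · 2 ·
      -- x does, the second in the extension.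
      extend-closed : ∀ {g k} (o : HasOrder E g k) → TwoClosed (extend E g k o)
      extend-closed {g} {k} o {x} 2x∈ with order-odd o
      ... | w , odd = ∈-cancel E⁺ (∈-· E⁺ w 2x∈) (subst (_∈ E⁺) (trans (cong (_· x) odd) (odd· w x)) (⊆-extend E g k o kx∈))
        where
        E⁺ = extend E g k o
        kx∈ : k · x ∈ E
        kx∈ = closed (subst (_∈ E) (trans (·-· x k 2) (trans (cong (_· x) (*-comm k 2)) (sym (·-· x 2 k)))) (k·extend∈ o 2x∈))

  abstract
    -- Cyclic extensions climb from E to all of G; each multiplies the size by the order of an
    -- element of a quotient without involution, which is odd.
    odd-index : ∀ E → TwoClosed E → ∃ λ q → Odd q × n ≡ q * size E
    odd-index E closed = go E closed (<-wellFounded _)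
      where
      go : ∀ E → TwoClosed E → Acc _<_ (remaining E) → ∃ λ q → Odd q × n ≡ q * size E
      go E closed (acc rec) = case all∈? E of λ where
        (inj₁ all)      → 1 , (0 , refl) , sym (trans (*-identityˡ (size E)) (size-all E all))
        (inj₂ (g , g∉)) → let
          k , o = order E g
          E⁺ = extend E g k o
          q , odd-q , e = go E⁺ (extend-closed E closed o) (rec (extend-remaining {E} {g} {k} o g∉))
          in q * k , odd-* odd-q (order-odd E closed o) , trans e (sym (*-assoc q k (size E)))

  abstract
    -- An outside element whose double is inside has order exactly 2 over E, so adjoining it doubles
    -- the size. When none is left, E is closed.
    two-subgroup : ∃ λ E → TwoClosed E × ∃ λ a → size E ≡ 2 ^ a
    two-subgroup = go trivial 0 refl (<-wellFounded _)
      where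
      go : ∀ E a → size E ≡ 2 ^ a → Acc _<_ (remaining E) → ∃ λ E → TwoClosed E × ∃ λ a → size E ≡ 2 ^ a
      go E a e (acc rec) with Fin.any? (λ x → ¬? (x ∈? E) ×-dec (2 · x ∈? E))
      ... | no none = E , (λ {x} 2x∈ → decidable-stable (x ∈? E) λ x∉ → none (x , x∉ , 2x∈)) , a , e
      ... | yes (g , g∉ , 2g∈) with order E g
      ...   | k , o = go (extend E g k o) (suc a) (cong₂ _*_ k≡2 e)
                        (rec (extend-remaining {E} {g} {k} o g∉))
        where
        k≡2 : k ≡ 2
        k≡2 = ≤-antisym (∣⇒≤ (minimal o 2g∈)) (order>1 o g∉)

  isSylow : ∀ E → TwoClosed E → ∀ a → size E ≡ 2 ^ a → IsSylow 2 (elements E)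
  isSylow E closed a e =
    ( ∈-elements E (∈-𝟘 E)
    , (λ x∈ y∈ → ∈-elements E (∈-⊕ E (elements-∈ E x∈) (elements-∈ E y∈)))
    , (λ x∈ → ∈-elements E (∈-⊖ E (elements-∈ E x∈)))) ,
    a , trans (card-elements E) e , index-odd (odd-index E closed)
    where
    index-odd : ∃ (λ q → Odd q × n ≡ q * size E) → (2 ^ a ∣ n) × ¬ (2 ^ suc a ∣ n)
    index-odd (q , (w , refl) , n≡) = divides q n≡q2ᵃ , λ (divides r n≡r2ᵃ) →
      odd≢even w r (*-cancelʳ-≡ (1 + 2 * w) (2 * r) (2 ^ a) {{m^n≢0 2 a}}
        (trans (sym n≡q2ᵃ) (trans n≡r2ᵃ (trans (sym (*-assoc r 2 (2 ^ a))) (cong (_* 2 ^ a) (*-comm r 2))))))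
      where
      n≡q2ᵃ : n ≡ q * 2 ^ a
      n≡q2ᵃ = trans n≡ (cong (q *_) e)

  -- If g has order 2w, then s = w · g. If the order is odd, 𝟘 is the only solution and also serves
  -- as the default for s.
  cyclic-involution : ∀ g → ∃ λ s → ∀ i → 2 · i · g ≡ 𝟘 → i · g ≡ 𝟘 ⊎ i · g ≡ s
  cyclic-involution g with order trivial g
  ... | k , o with parity k
  ...   | inj₂ odd = 𝟘 , λ i 2ig≡𝟘 → inj₁ (∈-trivial (∼𝟘⇒∈ trivial (cofree o {i} {0}
            (mod-halve odd (free o (∼-refl trivial (trans (sym (·-· g 2 i)) 2ig≡𝟘)))))))
  ...   | inj₁ (w , refl) = w · g , half
    where
    half : ∀ i → 2 · i · g ≡ 𝟘 → i · g ≡ 𝟘 ⊎ i · g ≡ w · g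
    half i 2ig≡𝟘 with minimal o {2 * i} (0 , trans (sym (·-· g 2 i)) 2ig≡𝟘)
    ... | divides q e with parity q
    ...   | inj₁ (v , refl) = inj₁ (trans (cong (_· g) i≡) (trans (sym (·-· g v (2 * w)))
              (trans (cong (v ·_) (∈-trivial (k·g∈ o))) (·-𝟘 v))))
      where
      lem : ∀ v w → 2 * v * (2 * w) ≡ 2 * (v * (2 * w))
      lem = solve-∀
      i≡ : i ≡ v * (2 * w)
      i≡ = *-cancelˡ-≡ _ _ 2 (trans e (lem v w))
    ...   | inj₂ (v , refl) = inj₂ (trans (cong (_· g) i≡) (trans (·-+ g w (v * (2 * w))) (trans (cong (w · g ⊕_)
              (trans (sym (·-· g v (2 * w))) (trans (cong (v ·_) (∈-trivial (k·g∈ o))) (·-𝟘 v)))) (⊕-identityʳ _))))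
      where
      lem : ∀ v w → (1 + 2 * v) * (2 * w) ≡ 2 * (w + v * (2 * w))
      lem = solve-∀
      i≡ : i ≡ w + v * (2 * w)
      i≡ = *-cancelˡ-≡ _ _ 2 (trans e (lem v w))

  pow≡· : ∀ g k → pow g k ≡ k · g
  pow≡· g zero    = refl
  pow≡· g (suc k) = cong (g ⊕_) (pow≡· g k)

  record UniqueInvolution : Set where
    field
      t      : Fin n
      t≢𝟘    : t ≢ 𝟘
      2t≡𝟘   : 2 · t ≡ 𝟘
      unique : ∀ {x} → 2 · x ≡ 𝟘 → x ≡ 𝟘 ⊎ x ≡ t

  abstract
    involution? : Dec (∃ λ t → t ≢ 𝟘 × 2 · t ≡ 𝟘)
    involution? = Fin.any? λ t → ¬? (t Fin.≟ 𝟘) ×-dec (2 · t Fin.≟ 𝟘)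

  module _ (sylow : ∀ P → IsSylow 2 P → IsCyclic P × IsNontrivial P) where

    -- Without an involution the trivial subgroup would be a Sylow 2-subgroup. The double negation
    -- is removed later by `involution?`.
    ¬¬involution : ¬ ¬ (∃ λ t → t ≢ 𝟘 × 2 · t ≡ 𝟘)
    ¬¬involution none = contradiction (subst (1 <_) (card-elements trivial) nontrivial) λ { (s≤s ()) }
      where
      closed : TwoClosed trivial
      closed {x} 2x∈ = 0 , decidable-stable (x Fin.≟ 𝟘) λ x≢𝟘 → none (x , x≢𝟘 , ∈-trivial 2x∈)
      nontrivial : IsNontrivial (elements trivial)
      nontrivial = proj₂ (sylow (elements trivial) (isSylow trivial closed 0 refl))

    abstract
      -- A closed subgroup contains every x with 2 · x ≡ 𝟘; here such an x is a multiple of the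
      -- generator of a cyclic group.
      involutions : ∃ λ s → ∀ {x} → 2 · x ≡ 𝟘 → x ≡ 𝟘 ⊎ x ≡ s
      involutions = let
        E , closed , a , e = two-subgroup
        g , _ , generates = proj₁ (sylow (elements E) (isSylow E closed a e))
        s , half = cyclic-involution g
        in s , λ {x} 2x≡𝟘 → let
          i , x≡pow = generates (∈-elements E (closed (subst (_∈ E) (sym 2x≡𝟘) (∈-𝟘 E))))
          x≡ig = trans x≡pow (pow≡· g i)
          in subst (λ y → y ≡ 𝟘 ⊎ y ≡ s) (sym x≡ig) (half i (trans (cong (2 ·_) (sym x≡ig)) 2x≡𝟘))

    unique-involution : UniqueInvolution
    unique-involution = record { t = t ; t≢𝟘 = t≢𝟘 ; 2t≡𝟘 = 2t≡𝟘 ; unique = unique }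
      where
      t,nontrivial = decidable-stable involution? ¬¬involution
      t = proj₁ t,nontrivial
      t≢𝟘 = proj₁ (proj₂ t,nontrivial)
      2t≡𝟘 = proj₂ (proj₂ t,nontrivial)
      unique : ∀ {x} → 2 · x ≡ 𝟘 → x ≡ 𝟘 ⊎ x ≡ t
      unique 2x≡𝟘 with proj₂ involutions 2x≡𝟘 | proj₂ involutions 2t≡𝟘
      ... | inj₁ x≡𝟘 | _        = inj₁ x≡𝟘
      ... | inj₂ _   | inj₁ t≡𝟘 = contradiction t≡𝟘 t≢𝟘
      ... | inj₂ x≡s | inj₂ t≡s = inj₂ (trans x≡s (sym t≡s))

-- Primes, and enlarging Z by a section (ℤ/p)²

argmax : ∀ {n} (f : Fin n → ℕ) → Fin n → ∃ λ i → ∀ j → f j ≤ f i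
argmax {suc zero}    f _ = zero , λ { zero → ≤-refl }
argmax {suc (suc n)} f _ with argmax (f ∘ suc) zero
... | i , max with ≤-total (f zero) (f (suc i))
...   | inj₁ le = suc i , λ { zero → le ; (suc j) → max j }
...   | inj₂ ge = zero , λ { zero → ≤-refl ; (suc j) → ≤-trans (max j) ge }

prime-divisor : ∀ k → 1 < k → ∃ λ p → Prime p × p ∣ k
prime-divisor k@(suc _) 1<k with factorise k
... | record { factors = [] ; isFactorisation = k≡1 } = contradiction (sym k≡1) (<⇒≢ 1<k)
... | record { factors = p ∷ ps ; isFactorisation = eq ; factorsPrime = pr ∷ _ } =
      p , pr , divides (product ps) (trans eq (*-comm p (product ps)))

prime∤⇒coprime : ∀ {p m} → Prime p → p ∤ m → Coprime p m
prime∤⇒coprime pr p∤m (d∣p , d∣m) with prime⇒irreducible pr d∣p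
... | inj₁ d≡1 = d≡1
... | inj₂ refl = contradiction d∣m p∤m

odd-prime : ∀ {p} → Prime p → p ≡ 2 ⊎ Odd p
odd-prime {p} pr with parity p
... | inj₂ odd = inj₂ odd
... | inj₁ (w , refl) with prime⇒irreducible pr {2} (m∣m*n w)
...   | inj₂ 2≡p = inj₁ (sym 2≡p)

module Cores {n} (G : FiniteAbelianGroup n) where
  open Additive G
  open Extensions G
  open Involutions G

  coprime-∈ : ∀ {E a b x} → Coprime a b → a · x ∈ E → b · x ∈ E → x ∈ E
  coprime-∈ {E} {x = x} coprime ax∈ bx∈ = subst (_∈ E) (⊕-identityʳ x)
    (subst (λ k → k · x ∈ E) (coprime (minimal o ax∈ , minimal o bx∈)) (k·g∈ o))
    where o = proj₂ (order E x)

  prime-order : ∀ {E p x} → Prime p → p · x ∈ E → x ∉ E → HasOrder E x p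
  prime-order {E} {p} {x} pr px∈ x∉ = record
    { order≢0 = prime⇒nonZero pr
    ; k·g∈    = px∈
    ; minimal = λ dx∈ → subst (_∣ _) (k≡p) (minimal o dx∈)
    }
    where
    o = proj₂ (order E x)
    k≡p : proj₁ (order E x) ≡ p
    k≡p with prime⇒irreducible pr (minimal o px∈)
    ... | inj₂ eq = eq
    ... | inj₁ eq = contradiction (subst (_∈ E) (⊕-identityʳ x) (subst (λ k → k · x ∈ E) eq (k·g∈ o))) x∉

  -- spread is an enumeration of θ − 1 for a permutation θ of the subgroup, such that
  -- θ − 1, θ and θ + 1 are all permutations.
  record Core : Set where
    no-eta-equality
    field
      enum       : Enumeration
      odd        : Odd (size enum)
      harmonious : Harmonious enum
      spread     : ℕ → Fin n
      spread∈    : ∀ i → spread i ∈ enum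
      spread-injective₀ : ∀ {i i′} → spread i ≡ spread i′ → i ≡ i′ [mod size enum ]
      spread-injective₁ : ∀ {i i′} → spread i ⊕ at enum i ≡ spread i′ ⊕ at enum i′ → i ≡ i′ [mod size enum ]
      spread-injective₂ : ∀ {i i′} → spread i ⊕ 2 · at enum i ≡ spread i′ ⊕ 2 · at enum i′ → i ≡ i′ [mod size enum ]

  open Core public

  trivial-core : Core
  trivial-core = record
    { enum = trivial
    ; odd = 0 , refl
    ; harmonious = λ {i} {i′} _ → all≡[mod1] i i′
    ; spread = λ _ → 𝟘
    ; spread∈ = λ _ → ∈-𝟘 trivial
    ; spread-injective₀ = λ {i} {i′} _ → all≡[mod1] i i′
    ; spread-injective₁ = λ {i} {i′} _ → all≡[mod1] i i′
    ; spread-injective₂ = λ {i} {i′} _ → all≡[mod1] i i′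
    }

  module Enlarge (C : Core) {g x p} (odd-p : Odd p) (og : HasOrder (enum C) g p)
                 (ox : HasOrder (extend (enum C) g p og) x p) (px∈ : p · x ∈ enum C) where

    E E₁ E₂ : Enumeration
    E  = enum C
    E₁ = extend E g p og
    E₂ = extend E₁ x p ox

    instance
      p≢0 : NonZero p
      p≢0 = order≢0 og

    -- The coefficient of x is determined modulo `E₁`. As p · x lies in E, the x-part then cancels
    -- modulo E and leaves the coefficient of g.
    independent : ∀ {a a′ b b′ h h′} → h ∈ E → h′ ∈ E → (a · g ⊕ b · x) ⊕ h ≡ (a′ · g ⊕ b′ · x) ⊕ h′ →
                  a ≡ a′ [mod p ] × b ≡ b′ [mod p ]
    independent {a} {a′} {b} {b′} {h} {h′} h∈ h′∈ e = a≡a′ , b≡b′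
      where
      ag⊕bx∼ : a · g ⊕ b · x ∼⟨ E ⟩ a′ · g ⊕ b′ · x
      ag⊕bx∼ = ∼-trans E (∼-sym E (∼-⊕∈ E h∈)) (∼-trans E (∼-refl E e) (∼-⊕∈ E h′∈))
      bx∼₁ : ∀ a b {h} → h ∈ E → (a · g ⊕ b · x) ⊕ h ∼⟨ E₁ ⟩ b · x
      bx∼₁ a b {h} h∈ = a · g ⊕ h , ∈-extend E g p og a h∈ ,
        solve 3 (λ a b h → ((a :⊕ b) :⊕ h) ⊜ (b :⊕ (a :⊕ h))) refl (a · g) (b · x) h
      b≡b′ : b ≡ b′ [mod p ]
      b≡b′ = free ox (∼-trans E₁ (∼-sym E₁ (bx∼₁ a b h∈)) (∼-trans E₁ (∼-refl E₁ e) (bx∼₁ a′ b′ h′∈)))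
      bx∼ : ∀ {b b′} → b ≡ b′ [mod p ] → b · x ∼⟨ E ⟩ b′ · x
      bx∼ {b} {b′} (cong-by u v e) = ∼-trans E (∼-sym E (shift b u)) (∼-trans E (∼-refl E (cong (_· x) e)) (shift b′ v))
        where
        shift : ∀ b u → (b + u * p) · x ∼⟨ E ⟩ b · x
        shift b u = u · p · x , ∈-· E u px∈ , trans (·-+ x b (u * p)) (cong (b · x ⊕_) (sym (·-· x u p)))
      a≡a′ : a ≡ a′ [mod p ]
      a≡a′ = free og (∼-cancelˡ E (b · x)
        (∼-trans E (∼-refl E (⊕-comm _ _)) (∼-trans E ag⊕bx∼
          (∼-trans E (∼-⊕ E (∼-refl E refl) (∼-sym E (bx∼ b≡b′))) (∼-refl E (⊕-comm _ _))))))

    digit₁ digit₂ rest : ℕ → ℕ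
    digit₁ i = (i / p) % p
    digit₂ i = i % p
    rest   i = (i / p) / p

    -- The coefficients need not be reduced modulo p, so their multiples may spill into E. Hence the
    -- order of steps: congruence yields the digits, equal digits make the coefficients equal as
    -- numbers, and only then are they cancelled to compare the parts in E.
    combine-injective : (A B : ℕ → ℕ → ℕ) (V : ℕ → Fin n) → (∀ l → V l ∈ E) →
      (∀ {l l′} → V l ≡ V l′ → l ≡ l′ [mod size E ]) →
      (∀ {j j′ k k′} → A j k ≡ A j′ k′ [mod p ] → B j k ≡ B j′ k′ [mod p ] → j ≡ j′ [mod p ] × k ≡ k′ [mod p ]) →
      ∀ {i i′} → (A (digit₁ i) (digit₂ i) · g ⊕ B (digit₁ i) (digit₂ i) · x) ⊕ V (rest i)
               ≡ (A (digit₁ i′) (digit₂ i′) · g ⊕ B (digit₁ i′) (digit₂ i′) · x) ⊕ V (rest i′) →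
      i ≡ i′ [mod size E₂ ]
    combine-injective A B V V∈ V-injective invert {i} {i′} e =
      mod-digits p d₂ (mod-digits p d₁ (V-injective (⊕-cancelˡ (A (digit₁ i) (digit₂ i) · g ⊕ B (digit₁ i) (digit₂ i) · x) _ _
        (trans e (cong₂ (λ j k → (A j k · g ⊕ B j k · x) ⊕ V (rest i′)) (sym d₁) (sym d₂))))))
      where
      AB = independent {A (digit₁ i) (digit₂ i)} {A (digit₁ i′) (digit₂ i′)} (V∈ (rest i)) (V∈ (rest i′)) e
      jk = invert (proj₁ AB) (proj₂ AB)
      d₁ : digit₁ i ≡ digit₁ i′
      d₁ = mod-unique (m%n<n (i / p) p) (m%n<n (i′ / p) p) (proj₁ jk)
      d₂ : digit₂ i ≡ digit₂ i′
      d₂ = mod-unique (m%n<n i p) (m%n<n i′ p) (proj₂ jk)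

    -- The matrix [[0,1],[2,0]] and its sums with 1 and 2 have determinants −2, −1 and 2,
    -- hence are invertible modulo every odd p.
    enlarge : Core
    enlarge = record
      { enum = E₂
      ; odd = odd-* odd-p (odd-* odd-p (odd C))
      ; harmonious = extend-harmonious E₁ x p ox odd-p (odd-* odd-p (odd C))
                       (extend-harmonious E g p og odd-p (odd C) (harmonious C))
      ; spread = spread⁺
      ; spread∈ = λ i → subst (_∈ E₂) (⊕-swap (2 * digit₁ i) (digit₂ i) (spread C (rest i)))
          (∈-extend E₁ x p ox (2 * digit₁ i) (∈-extend E g p og (digit₂ i) (spread∈ C (rest i))))
      ; spread-injective₀ = combine-injective (λ j k → k) (λ j k → 2 * j) (spread C) (spread∈ C) (spread-injective₀ C)
          λ a b → mod-halve odd-p b , a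
      ; spread-injective₁ = λ {i} {i′} e → combine-injective (λ j k → k + j) (λ j k → 2 * j + k) _
          (λ l → ∈-⊕ E (spread∈ C l) (l , refl)) (spread-injective₁ C) invert₁
          (trans (sym (regroup₁ i)) (trans e (regroup₁ i′)))
      ; spread-injective₂ = λ {i} {i′} e → combine-injective (λ j k → k + 2 * j) (λ j k → 2 * j + 2 * k) _
          (λ l → ∈-⊕ E (spread∈ C l) (∈-· E 2 (l , refl))) (spread-injective₂ C) invert₂
          (trans (sym (regroup₂ i)) (trans e (regroup₂ i′)))
      }
      where
      spread⁺ : ℕ → Fin n
      spread⁺ i = (digit₂ i · g ⊕ (2 * digit₁ i) · x) ⊕ spread C (rest i)
      ⊕-swap : ∀ a b h → a · x ⊕ (b · g ⊕ h) ≡ (b · g ⊕ a · x) ⊕ h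
      ⊕-swap a b h = solve 3 (λ a b h → (a :⊕ (b :⊕ h)) ⊜ ((b :⊕ a) :⊕ h)) refl (a · x) (b · g) h
      regroup₁ : ∀ i → spread⁺ i ⊕ at E₂ i ≡
        ((digit₂ i + digit₁ i) · g ⊕ (2 * digit₁ i + digit₂ i) · x) ⊕ (spread C (rest i) ⊕ at E (rest i))
      regroup₁ i = trans
        (solve 6 (λ a b w c d h → (((a :⊕ b) :⊕ w) :⊕ (c :⊕ (d :⊕ h))) ⊜ (((a :⊕ d) :⊕ (b :⊕ c)) :⊕ (w :⊕ h))) refl
          (digit₂ i · g) ((2 * digit₁ i) · x) (spread C (rest i)) (digit₂ i · x) (digit₁ i · g) (at E (rest i)))
        (sym (cong₂ (λ a b → (a ⊕ b) ⊕ (spread C (rest i) ⊕ at E (rest i)))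
          (·-+ g (digit₂ i) (digit₁ i)) (·-+ x (2 * digit₁ i) (digit₂ i))))
      regroup₂ : ∀ i → spread⁺ i ⊕ 2 · at E₂ i ≡
        ((digit₂ i + 2 * digit₁ i) · g ⊕ (2 * digit₁ i + 2 * digit₂ i) · x) ⊕ (spread C (rest i) ⊕ 2 · at E (rest i))
      regroup₂ i = trans (cong (spread⁺ i ⊕_) double) (trans
        (solve 6 (λ a b w c d h → (((a :⊕ b) :⊕ w) :⊕ (c :⊕ (d :⊕ h))) ⊜ (((a :⊕ d) :⊕ (b :⊕ c)) :⊕ (w :⊕ h))) refl
          (digit₂ i · g) ((2 * digit₁ i) · x) (spread C (rest i)) ((2 * digit₂ i) · x) ((2 * digit₁ i) · g) (2 · at E (rest i)))
        (sym (cong₂ (λ a b → (a ⊕ b) ⊕ (spread C (rest i) ⊕ 2 · at E (rest i)))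
          (·-+ g (digit₂ i) (2 * digit₁ i)) (·-+ x (2 * digit₁ i) (2 * digit₂ i)))))
        where
        double : 2 · at E₂ i ≡ (2 * digit₂ i) · x ⊕ ((2 * digit₁ i) · g ⊕ 2 · at E (rest i))
        double = trans (·-⊕ _ _ 2) (cong₂ _⊕_ (·-· x 2 (digit₂ i))
          (trans (·-⊕ _ _ 2) (cong (_⊕ 2 · at E (rest i)) (·-· g 2 (digit₁ i)))))
      invert₁ : ∀ {j j′ k k′} → k + j ≡ k′ + j′ [mod p ] → 2 * j + k ≡ 2 * j′ + k′ [mod p ] →
                j ≡ j′ [mod p ] × k ≡ k′ [mod p ]
      invert₁ {j} {j′} {k} {k′} a b = j≡j′ , mod-cancelʳ j (mod-trans a (mod-+ˡ k′ (mod-sym j≡j′)))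
        where
        lem : ∀ j k → 2 * j + k ≡ (k + j) + j
        lem = solve-∀
        j≡j′ : j ≡ j′ [mod p ]
        j≡j′ = mod-cancelˡ (k + j) (mod-trans (mod-refl (sym (lem j k)))
          (mod-trans b (mod-trans (mod-refl (lem j′ k′)) (mod-+ (mod-sym a) (mod-refl refl)))))
      invert₂ : ∀ {j j′ k k′} → k + 2 * j ≡ k′ + 2 * j′ [mod p ] → 2 * j + 2 * k ≡ 2 * j′ + 2 * k′ [mod p ] →
                j ≡ j′ [mod p ] × k ≡ k′ [mod p ]
      invert₂ {j} {j′} {k} {k′} a b = mod-halve odd-p (mod-cancelˡ k (mod-trans a (mod-+ (mod-sym k≡k′) (mod-refl refl)))) , k≡k′
        where
        lem : ∀ j k → 2 * j + 2 * k ≡ (k + 2 * j) + k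
        lem = solve-∀
        k≡k′ : k ≡ k′ [mod p ]
        k≡k′ = mod-cancelˡ (k + 2 * j) (mod-trans (mod-refl (sym (lem j k)))
          (mod-trans b (mod-trans (mod-refl (lem j′ k′)) (mod-+ (mod-sym a) (mod-refl refl)))))

  open Enlarge public using (enlarge)

-- Making the quotient by Z cyclic

module Frames {n} (G : FiniteAbelianGroup n) (involution : Involutions.UniqueInvolution G) where
  open Additive G
  open Extensions G
  open Involutions G
  open Cores G
  open UniqueInvolution involution

  ord : Enumeration → Fin n → ℕ
  ord E x = proj₁ (order E x)

  module Maximal (E : Enumeration) {g M} (o : HasOrder E g M) (max : ∀ x → ord E x ≤ M) where

    E⁺ : Enumeration
    E⁺ = extend E g M o

    E⊆E⁺ : ∀ {x} → x ∈ E → x ∈ E⁺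
    E⊆E⁺ = ⊆-extend E g M o

    -- Such an x has order at least M, hence exactly M.
    M·∈ : ∀ {x} → (∀ d → d · x ∈ E → d · g ∈ E) → M · x ∈ E
    M·∈ {x} dominates with order E x | max x
    ... | l , oₓ | l≤M = subst (λ k → k · x ∈ E) (≤-antisym l≤M M≤l) (k·g∈ oₓ)
      where
      M≤l : M ≤ l
      M≤l = ∣⇒≤ {{order≢0 oₓ}} (minimal o (dominates l (k·g∈ oₓ)))

    module _ {x} (x∉ : x ∉ E⁺) {p} (p-prime : Prime p) (px∈ : p · x ∈ E⁺) where

      i : ℕ
      i = proj₁ (split-extend E g M o px∈)

      px∼ig : p · x ∼⟨ E ⟩ i · g
      px∼ig = let _ , h , _ , h∈ , e = split-extend E g M o px∈ in h , h∈ , e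

      -- Otherwise M · x has order dividing p over E, prime to the order M of g, so every multiplier
      -- that sends `M · x ⊕ g` into E does so for g. By maximality M sends this sum into E. That
      -- forces M · x ∈ E, and together with p · x ∈ E⁺ also x ∈ E⁺.
      p∣M : p ∣ M
      p∣M with p ∣? M
      ... | yes p∣M = p∣M
      ... | no  p∤M = contradiction (coprime-∈ {E⁺} coprime px∈ (E⊆E⁺ Mx∈)) x∉
        where
        coprime : Coprime p M
        coprime = prime∤⇒coprime p-prime p∤M
        pMx∈ : p · M · x ∈ E
        pMx∈ = ∈-resp-∼ E (∼-trans E (∼-refl E swap) (∼-· E M px∼ig))
                 (subst (_∈ E) (trans (·-· g i M) (trans (cong (_· g) (*-comm i M)) (sym (·-· g M i)))) (∈-· E i (k·g∈ o)))
          where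
          swap : p · M · x ≡ M · p · x
          swap = trans (·-· x p M) (trans (cong (_· x) (*-comm p M)) (sym (·-· x M p)))
        dominates : ∀ d → d · (M · x ⊕ g) ∈ E → d · g ∈ E
        dominates d dx∈ with coprime-divisor {M} {p} {d} (λ (a , b) → coprime (b , a)) (minimal o pdg∈)
          where
          pdg∈ : (p * d) · g ∈ E
          pdg∈ = ∈-cancel E (∈-· E d pMx∈) (subst (_∈ E) e (∈-· E p dx∈))
            where
            open ≡-Reasoning
            e : p · d · (M · x ⊕ g) ≡ (p * d) · g ⊕ d · p · M · x
            e = begin
              p · d · (M · x ⊕ g)              ≡⟨ ·-· _ p d ⟩
              (p * d) · (M · x ⊕ g)            ≡⟨ ·-⊕ _ _ (p * d) ⟩
              (p * d) · M · x ⊕ (p * d) · g    ≡⟨ cong (λ k → k · M · x ⊕ (p * d) · g) (*-comm p d) ⟩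
              (d * p) · M · x ⊕ (p * d) · g    ≡⟨ cong (_⊕ (p * d) · g) (·-· (M · x) d p) ⟨
              d · p · M · x ⊕ (p * d) · g      ≡⟨ ⊕-comm _ _ ⟩
              (p * d) · g ⊕ d · p · M · x      ∎
        ... | divides q refl = subst (_∈ E) (·-· g q M) (∈-· E q (k·g∈ o))
        Mx∈ : M · x ∈ E
        Mx∈ = coprime-∈ {E} coprime pMx∈ (∈-cancel E (k·g∈ o) (subst (_∈ E) (·-⊕ _ _ M) (M·∈ dominates)))

      M/p : ℕ
      M/p = _∣_.quotient p∣M

      M≡ : M ≡ M/p * p
      M≡ = _∣_.equality p∣M

      M/p·g∉ : M/p · g ∉ E
      M/p·g∉ M/p·g∈ = <⇒≱ M/p<M (∣⇒≤ {{M/p≢0}} (minimal o M/p·g∈))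
        where
        M/p≢0 : NonZero M/p
        M/p≢0 = m*n≢0⇒m≢0 M/p {{subst NonZero M≡ (order≢0 o)}}
        M/p<M : M/p < M
        M/p<M = subst (M/p <_) (sym M≡) (m<m*n M/p p {{M/p≢0}} (nonTrivial⇒n>1 p {{prime⇒nonTrivial p-prime}}))

      p·M/p·g∈ : p · M/p · g ∈ E
      p·M/p·g∈ = subst (_∈ E) (trans (cong (_· g) (trans M≡ (*-comm M/p p))) (sym (·-· g p M/p))) (k·g∈ o)

      -- Such a y would have order p * M over E, beyond the maximum: maximality gives M · y ∈ E,
      -- although M · y is congruent to M/p · g.
      ¬p·y∼g : ∀ y → ¬ (p · y ∼⟨ E ⟩ g)
      ¬p·y∼g y py∼g = M/p·g∉ (∈-resp-∼ E (∼-sym E (∼-· E M/p py∼g))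
          (subst (_∈ E) (trans (cong (_· y) M≡) (sym (·-· y M/p p))) (M·∈ dominates)))
        where
        dominates : ∀ d → d · y ∈ E → d · g ∈ E
        dominates d dy∈ = ∈-resp-∼ E (∼-· E d (∼-sym E py∼g))
          (subst (_∈ E) (trans (·-· y p d) (trans (cong (_· y) (*-comm p d)) (sym (·-· y d p)))) (∈-· E p dy∈))

      -- If p and i were coprime, Bézout and p · x ∼ i · g would express g modulo E as p times an
      -- element. The two cases of `divided` are the two signs.
      p∣i : p ∣ i
      p∣i with p ∣? i
      ... | yes p∣i = p∣i
      ... | no  p∤i = contradiction (proj₂ divided) (¬p·y∼g (proj₁ divided))
        where
        quotient∼g : ∀ a b → p · a ∼⟨ E ⟩ g ⊕ p · b → p · (a ⊕ ⊖ b) ∼⟨ E ⟩ g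
        quotient∼g a b pa∼ = ∼-cancelˡ E (p · b) (∼-trans E (∼-refl E e) (∼-trans E pa∼ (∼-refl E (⊕-comm _ _))))
          where
          e : p · b ⊕ p · (a ⊕ ⊖ b) ≡ p · a
          e = trans (⊕-comm _ _) (trans (sym (·-⊕ _ _ p)) (cong (p ·_) ([x⊖y]⊕y a b)))
        ui·g∼ : ∀ u → (u * i) · g ∼⟨ E ⟩ p · u · x
        ui·g∼ u = ∼-trans E (∼-refl E (sym (·-· g u i))) (∼-trans E (∼-· E u (∼-sym E px∼ig))
          (∼-refl E (trans (·-· x u p) (trans (cong (_· x) (*-comm u p)) (sym (·-· x p u))))))
        vp·g : ∀ v → (v * p) · g ≡ p · v · g
        vp·g v = trans (cong (_· g) (*-comm v p)) (sym (·-· g p v))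
        divided : ∃ λ y → p · y ∼⟨ E ⟩ g
        divided with coprime-Bézout (prime∤⇒coprime p-prime p∤i)
        ... | Bézout.+- v u e = v · g ⊕ ⊖ (u · x) , quotient∼g (v · g) (u · x)
              (∼-trans E (∼-refl E (trans (sym (vp·g v)) (cong (_· g) (sym e)))) (∼-⊕ E (∼-refl E refl) (ui·g∼ u)))
        ... | Bézout.-+ v u e = u · x ⊕ ⊖ (v · g) , quotient∼g (u · x) (v · g)
              (∼-trans E (∼-sym E (ui·g∼ u)) (∼-refl E (trans (cong (_· g) (sym e)) (cong (g ⊕_) (vp·g v)))))

      i/p : ℕ
      i/p = _∣_.quotient p∣i

      -- The correction of x by a multiple of g whose p-fold falls into E itself, not just into E⁺.
      y : Fin n
      y = x ⊕ ⊖ (i/p · g)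

      y⊕≡x : y ⊕ i/p · g ≡ x
      y⊕≡x = [x⊖y]⊕y x (i/p · g)

      py∈ : p · y ∈ E
      py∈ = ∼𝟘⇒∈ E (∼-cancelˡ E (i · g) (∼-trans E (∼-refl E e) (∼-trans E px∼ig (∼-refl E (sym (⊕-identityʳ _))))))
        where
        e : i · g ⊕ p · y ≡ p · x
        e = trans (⊕-comm _ _) (trans (cong (p · y ⊕_) (trans (cong (_· g) (trans (_∣_.equality p∣i) (*-comm i/p p))) (sym (·-· g p i/p))))
              (trans (sym (·-⊕ y (i/p · g) p)) (cong (p ·_) y⊕≡x)))

      g∈E⁺ : g ∈ E⁺
      g∈E⁺ = g∈extend E g M o

      y∉ : y ∉ E⁺
      y∉ y∈ = x∉ (subst (_∈ E⁺) y⊕≡x (∈-⊕ E⁺ y∈ (∈-· E⁺ i/p g∈E⁺)))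

      -- For p = 2, both y and M/p · g would be involutions modulo E. Multiplying by the odd ζ turns
      -- each into a true involution, hence into t; these cancel, so y ⊕ M/p · g lies in E and y in
      -- E⁺.
      p≢2 : Odd (size E) → p ≢ 2
      p≢2 (w , ζ≡) refl = y∉ (∈-cancel E⁺ (∈-· E⁺ M/p g∈E⁺) (E⊆E⁺ (odd-multiple (y ⊕ M/p · g) 2[y+g₁]∈ ζ[y+g₁]∈)))
        where
        ζ : ℕ
        ζ = size E
        odd-multiple : ∀ z → 2 · z ∈ E → ζ · z ∈ E → z ∈ E
        odd-multiple z 2z∈ ζz∈ = ∈-cancel E (∈-· E w 2z∈) (subst (_∈ E) (trans (cong (_· z) ζ≡) (odd· w z)) ζz∈)
        ζ·≡t : ∀ {z} → z ∉ E → 2 · z ∈ E → ζ · z ≡ t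
        ζ·≡t {z} z∉ 2z∈ with unique {ζ · z} (trans (·-· z 2 ζ) (trans (cong (_· z) (*-comm 2 ζ)) (trans (sym (·-· z ζ 2)) (size·∈ E 2z∈))))
        ... | inj₁ ζz≡𝟘 = contradiction (odd-multiple z 2z∈ (subst (_∈ E) (sym ζz≡𝟘) (∈-𝟘 E))) z∉
        ... | inj₂ ζz≡t = ζz≡t
        2[y+g₁]∈ : 2 · (y ⊕ M/p · g) ∈ E
        2[y+g₁]∈ = subst (_∈ E) (sym (·-⊕ _ _ 2)) (∈-⊕ E py∈ p·M/p·g∈)
        ζ[y+g₁]∈ : ζ · (y ⊕ M/p · g) ∈ E
        ζ[y+g₁]∈ = subst (_∈ E) (sym (trans (·-⊕ _ _ ζ) (trans (cong₂ _⊕_ (ζ·≡t (λ y∈ → y∉ (E⊆E⁺ y∈)) py∈) (ζ·≡t M/p·g∉ p·M/p·g∈))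
                     (trans (sym (2· t)) 2t≡𝟘)))) (∈-𝟘 E)

  record Frame : Set where
    no-eta-equality
    field
      core   : Core
      g      : Fin n
      M      : ℕ
      order-g : HasOrder (enum core) g M
      covers : ∀ x → x ∈ extend (enum core) g M order-g

  module _ (C : Core) {g M} (o : HasOrder (enum C) g M) (max : ∀ x → ord (enum C) x ≤ M) where

    private
      E : Enumeration
      E = enum C

    -- M/p · g and y have order p over E, and y ∉ E⁺ keeps y outside the span of the former: they
    -- generate the section (ℤ/p)².
    larger : ∀ {x p} → x ∉ extend E g M o → Prime p → p · x ∈ extend E g M o →
             ∃ λ C′ → remaining (enum C′) < remaining E
    larger {x} {p} x∉ p-prime px∈ = enlarge C odd-p og oy py∈ , <-trans
        (extend-remaining {extend E g₁ p og} {y x∉ p-prime px∈} {p} oy y∉₁)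
        (extend-remaining {E} {g₁} {p} og (M/p·g∉ x∉ p-prime px∈))
      where
      open Maximal E o max hiding (py∈)
      g₁ : Fin n
      g₁ = M/p x∉ p-prime px∈ · g
      py∈ : p · y x∉ p-prime px∈ ∈ E
      py∈ = Maximal.py∈ E o max x∉ p-prime px∈
      odd-p : Odd p
      odd-p = [ (λ p≡2 → contradiction p≡2 (p≢2 x∉ p-prime px∈ (odd C))) , (λ odd-p → odd-p) ]′ (odd-prime p-prime)
      og : HasOrder E g₁ p
      og = prime-order p-prime (p·M/p·g∈ x∉ p-prime px∈) (M/p·g∉ x∉ p-prime px∈)
      y∉₁ : y x∉ p-prime px∈ ∉ extend E g₁ p og
      y∉₁ y∈ = let j , h , _ , h∈ , e = split-extend E g₁ p og y∈ in
        y∉ x∉ p-prime px∈ (subst (_∈ E⁺) (sym e) (∈-⊕ E⁺ (∈-· E⁺ j (∈-· E⁺ (M/p x∉ p-prime px∈) (g∈E⁺ x∉ p-prime px∈))) (E⊆E⁺ h∈)))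
      oy : HasOrder (extend E g₁ p og) (y x∉ p-prime px∈) p
      oy = prime-order p-prime (⊆-extend E g₁ p og py∈) y∉₁

    step : Frame ⊎ ∃ λ C′ → remaining (enum C′) < remaining E
    step with all∈? (extend E g M o)
    ... | inj₁ all = inj₁ (record { core = C ; g = g ; M = M ; order-g = o ; covers = all })
    -- For a prime p dividing the order k of x over E⁺, the multiple k/p · x has order p.
    ... | inj₂ (x , x∉) = inj₂ (larger {k/p · x} k/p·x∉ p-prime (subst (_∈ E⁺) p·k/p·x (k·g∈ oₓ)))
      where
      E⁺ : Enumeration
      E⁺ = extend E g M o
      k = proj₁ (order E⁺ x)
      oₓ = proj₂ (order E⁺ x)
      p-divides = prime-divisor k (order>1 oₓ x∉)
      p = proj₁ p-divides
      p-prime : Prime p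
      p-prime = proj₁ (proj₂ p-divides)
      k/p = _∣_.quotient (proj₂ (proj₂ p-divides))
      k≡ : k ≡ k/p * p
      k≡ = _∣_.equality (proj₂ (proj₂ p-divides))
      p·k/p·x : k · x ≡ p · k/p · x
      p·k/p·x = trans (cong (_· x) (trans k≡ (*-comm k/p p))) (sym (·-· x p k/p))
      k/p≢0 : NonZero k/p
      k/p≢0 = m*n≢0⇒m≢0 k/p {{subst NonZero k≡ (order≢0 oₓ)}}
      k/p·x∉ : k/p · x ∉ E⁺
      k/p·x∉ k/p·x∈ = <⇒≱ (subst (k/p <_) (sym k≡) (m<m*n k/p p {{k/p≢0}} (nonTrivial⇒n>1 p {{prime⇒nonTrivial p-prime}})))
                          (∣⇒≤ {{k/p≢0}} (minimal oₓ k/p·x∈))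

  abstract
    frame : Frame
    frame = go trivial-core (<-wellFounded _)
      where
      go : ∀ C → Acc _<_ (remaining (enum C)) → Frame
      go C (acc rec) = let
        g , max = argmax (ord (enum C)) 𝟘
        in case step C (proj₂ (order (enum C) g)) max of λ where
          (inj₁ f)         → f
          (inj₂ (C′ , lt)) → go C′ (rec lt)

-- A cyclic listing of G that moves by t in half a turn

mod-cancel : ∀ {M a b c d} → a + c ≡ b + d [mod M ] → c ≡ d [mod M ] → a ≡ b [mod M ]
mod-cancel {c = c} p q = mod-cancelʳ c (mod-trans p (mod-+ˡ _ (mod-sym q)))

-- With N = 1 + 2w, i = N * i - w * (2 * i), and both terms are determined modulo 2N.
mod-2*odd : ∀ {N i i′} → Odd N → i ≡ i′ [mod 2 ] → i ≡ i′ [mod N ] → i ≡ i′ [mod 2 * N ]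
mod-2*odd {N} {i} {i′} (w , refl) p q = mod-cancel
    (mod-trans (mod-refl (sym (lem w i))) (mod-trans N*p (mod-refl (lem w i′)))) (mod-* w (mod-scale 2 q))
  where
  lem : ∀ w i → (1 + 2 * w) * i ≡ i + w * (2 * i)
  lem = solve-∀
  N*p : N * i ≡ N * i′ [mod 2 * N ]
  N*p = subst (λ K → N * i ≡ N * i′ [mod K ]) (*-comm N 2) (mod-scale N p)

chinese-remainder : ∀ {N} → Odd N → ∀ r l → ∃ λ k → k ≡ r [mod 2 ] × k ≡ l [mod N ]
chinese-remainder (w , refl) r l =
  -- This is r * N + (N + 1) * l: N is 1 modulo 2 and 0 modulo N, while N + 1 is 0 modulo 2 and 1
  -- modulo N.
  r * (1 + 2 * w) + (2 + 2 * w) * l ,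
  subst (λ k → k ≡ r [mod 2 ]) (sym (lem₂ w r l)) (mod-multiple r (r * w + (1 + w) * l)) ,
  subst (λ k → k ≡ l [mod 1 + 2 * w ]) (sym (lemₙ w r l)) (mod-multiple l (r + l))
  where
  lem₂ : ∀ w r l → r * (1 + 2 * w) + (2 + 2 * w) * l ≡ r + (r * w + (1 + w) * l) * 2
  lem₂ = solve-∀
  lemₙ : ∀ w r l → r * (1 + 2 * w) + (2 + 2 * w) * l ≡ l + (r + l) * (1 + 2 * w)
  lemₙ = solve-∀

odd≢even-mod : ∀ {M v w} → 1 + 2 * v ≡ 2 * w [mod 2 * M ] → ∀ {A : Set} → A
odd≢even-mod {M} {v} {w} (cong-by a b e) = contradiction (trans (sym (lem v a M)) (trans e (lem′ w b M))) (odd≢even (v + a * M) (w + b * M))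
  where
  lem : ∀ v a M → 1 + 2 * v + a * (2 * M) ≡ 1 + 2 * (v + a * M)
  lem = solve-∀
  lem′ : ∀ w b M → 2 * w + b * (2 * M) ≡ 2 * (w + b * M)
  lem′ = solve-∀

isOdd : ℕ → Bool
isOdd zero    = false
isOdd (suc n) = not (isOdd n)

isOdd-2+ : ∀ u v → isOdd (v + u * 2) ≡ isOdd v
isOdd-2+ zero    v = cong isOdd (+-identityʳ v)
isOdd-2+ (suc u) v = trans (cong isOdd (lem u v)) (trans (Bool.not-involutive _) (isOdd-2+ u v))
  where
  lem : ∀ u v → v + (2 + u * 2) ≡ 2 + (v + u * 2)
  lem = solve-∀

module Cycles {n} (G : FiniteAbelianGroup n) (involution : Involutions.UniqueInvolution G)
              (F : Frames.Frame G involution) where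
  open Additive G
  open Extensions G
  open Involutions G
  open Cores G
  open UniqueInvolution involution public
  open Frames.Frame F public

  Z : Enumeration
  Z = enum core

  ζ : ℕ
  ζ = size Z

  ζ≢0 : NonZero ζ
  ζ≢0 = size≢0 Z

  odd-ζ : Odd ζ
  odd-ζ = odd core

  ζ·t≡t : ζ · t ≡ t
  ζ·t≡t = odd·-involution odd-ζ 2t≡𝟘

  t∉Z : t ∉ Z
  t∉Z t∈ = t≢𝟘 (trans (sym ζ·t≡t) (size·∈ Z t∈))

  double-injective : ∀ {x y} → 2 · x ≡ 2 · y → x ≡ y ⊎ x ≡ y ⊕ t
  double-injective {x} {y} e with unique {x ⊕ ⊖ y} (⊕-cancelˡ (2 · y) _ _ (begin
      2 · y ⊕ 2 · (x ⊕ ⊖ y)   ≡⟨ ·-⊕ y (x ⊕ ⊖ y) 2 ⟨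
      2 · (y ⊕ (x ⊕ ⊖ y))     ≡⟨ cong (2 ·_) (trans (⊕-comm y _) ([x⊖y]⊕y x y)) ⟩
      2 · x                   ≡⟨ e ⟩
      2 · y                   ≡⟨ ⊕-identityʳ _ ⟨
      2 · y ⊕ 𝟘               ∎))
    where open ≡-Reasoning
  ... | inj₁ d≡𝟘 = inj₁ (trans (sym ([x⊖y]⊕y x y)) (trans (cong (_⊕ y) d≡𝟘) (⊕-identityˡ y)))
  ... | inj₂ d≡t = inj₂ (trans (sym ([x⊖y]⊕y x y)) (trans (cong (_⊕ y) d≡t) (⊕-comm t y)))

  -- M annihilates G/Z. If M were odd, M · t would be t, putting t into Z.
  M-even : ∃ λ μ → M ≡ 2 * μ
  M-even with parity M
  ... | inj₁ even = even
  ... | inj₂ odd-M = contradiction (subst (_∈ Z) (odd·-involution odd-M 2t≡𝟘) (k·extend∈ Z order-g (covers t))) t∉Z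

  μ : ℕ
  μ = proj₁ M-even

  order-2μ : HasOrder Z g (2 * μ)
  order-2μ = subst (HasOrder Z g) (proj₂ M-even) order-g

  μ≢0 : NonZero μ
  μ≢0 = m*n≢0⇒n≢0 2 {{order≢0 order-2μ}}

  μ·g∉Z : μ · g ∉ Z
  μ·g∉Z μg∈ = <⇒≱ (m<m+n μ (subst (0 <_) (sym (+-identityʳ μ)) (>-nonZero⁻¹ μ {{μ≢0}})))
                   (∣⇒≤ {{μ≢0}} (minimal order-2μ μg∈))

  2μ·g∈Z : 2 · μ · g ∈ Z
  2μ·g∈Z = subst (_∈ Z) (sym (·-· g 2 μ)) (k·g∈ order-2μ)

  ζμ·g∼μ·g : ζ · μ · g ∼⟨ Z ⟩ μ · g
  ζμ·g∼μ·g = let w , ζ≡ = odd-ζ in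
    w · 2 · μ · g , ∈-· Z w 2μ·g∈Z , trans (cong (_· μ · g) ζ≡) (odd· w (μ · g))

  -- ζ · μ · g is annihilated by 2, and congruent to μ · g modulo Z because ζ is odd and 2 · μ · g ∈
  -- Z. As μ · g ∉ Z it is not 𝟘, so it is t.
  t∼μ·g : t ∼⟨ Z ⟩ μ · g
  t∼μ·g with unique {ζ · μ · g} (trans (·-· (μ · g) 2 ζ) (trans (cong (_· μ · g) (*-comm 2 ζ))
                (trans (sym (·-· (μ · g) ζ 2)) (size·∈ Z 2μ·g∈Z))))
  ... | inj₁ ζμg≡𝟘 = contradiction (∈-resp-∼ Z (∼-sym Z ζμ·g∼μ·g) (subst (_∈ Z) (sym ζμg≡𝟘) (∈-𝟘 Z))) μ·g∉Z
  ... | inj₂ ζμg≡t = subst (λ y → y ∼⟨ Z ⟩ μ · g) ζμg≡t ζμ·g∼μ·g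

  ·t-cong : ∀ {i i′} → i ≡ i′ [mod 2 ] → i · t ≡ i′ · t
  ·t-cong {i} {i′} (cong-by u v e) = trans (sym (shift i u)) (trans (cong (_· t) e) (shift i′ v))
    where
    shift : ∀ i u → (i + u * 2) · t ≡ i · t
    shift i u = trans (·-+ t i (u * 2)) (trans (cong (i · t ⊕_) (trans (sym (·-· t u 2)) (trans (cong (u ·_) 2t≡𝟘) (·-𝟘 u)))) (⊕-identityʳ _))

  order-t : HasOrder Z t 2
  order-t = prime-order prime[2] (subst (_∈ Z) (sym 2t≡𝟘) (∈-𝟘 Z)) t∉Z

  -- Lists Z together with t by the Chinese remainder theorem, one index being read modulo 2 and
  -- modulo ζ. Unlike `extend`, this makes half a period, ζ steps, a translation by t, because ζ · t
  -- ≡ t.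
  b : ℕ → Fin n
  b i = i · t ⊕ at Z i

  b-shift : ∀ l u → b (l + u * ζ) ≡ b l ⊕ u · t
  b-shift l u = trans (cong₂ _⊕_ (trans (·-+ t l (u * ζ)) (cong (l · t ⊕_) (trans (sym (·-· t u ζ)) (cong (u ·_) ζ·t≡t))))
                                 (at-cong Z (mod-multiple l u)))
                      (⊕-swapʳ (l · t) (u · t) (at Z l))

  t⊕Z⊆b : ∀ r {h} → h ∈ Z → ∃ λ k → r · t ⊕ h ≡ b k
  t⊕Z⊆b r (l , refl) = let k , k≡r , k≡l = chinese-remainder odd-ζ r l in
    k , sym (cong₂ _⊕_ (·t-cong k≡r) (at-cong Z k≡l))

  B : Enumeration
  B .size = 2 * ζ
  B .size≢0 = m*n≢0 2 ζ {{_}} {{ζ≢0}}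
  B .at = b
  B .at-cong {i} {i′} (cong-by u v e) = cong₂ _⊕_
    (·t-cong (cong-by (u * ζ) (v * ζ) (trans (cong (i +_) (lem u ζ)) (trans e (cong (i′ +_) (sym (lem v ζ)))))))
    (at-cong Z (cong-by (u * 2) (v * 2) (trans (cong (i +_) (*-assoc u 2 ζ)) (trans e (cong (i′ +_) (sym (*-assoc v 2 ζ)))))))
    where
    lem : ∀ u z → u * z * 2 ≡ u * (2 * z)
    lem = solve-∀
  B .at-injective {i} {i′} e = mod-2*odd odd-ζ i≡i′ (at-injective Z (⊕-cancelˡ (i · t) _ _
      (trans e (cong (_⊕ at Z i′) (sym (·t-cong i≡i′))))))
    where
    i≡i′ : i ≡ i′ [mod 2 ]
    i≡i′ = free order-t (∼-trans Z (∼-sym Z (∼-⊕∈ Z (i , refl))) (∼-trans Z (∼-refl Z e) (∼-⊕∈ Z (i′ , refl))))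
  B .at-0 = trans (⊕-identityˡ _) (at-0 Z)
  B .at-⊕ i j = let k , e = t⊕Z⊆b (i + j) (∈-⊕ Z (i , refl) (j , refl)) in
    k , trans (⊕-interchange _ _ _ _) (trans (cong (_⊕ (at Z i ⊕ at Z j)) (sym (·-+ t i j))) e)
  B .exponent i = trans (·-⊕ _ _ (2 * ζ)) (trans (cong₂ _⊕_ left right) (⊕-identityˡ 𝟘))
    where
    left : (2 * ζ) · i · t ≡ 𝟘
    left = trans (·-· t (2 * ζ) i) (trans (cong (_· t) (lem ζ i)) (·t-cong (mod-multiple 0 (ζ * i))))
      where
      lem : ∀ z i → 2 * z * i ≡ 0 + z * i * 2
      lem = solve-∀
    right : (2 * ζ) · at Z i ≡ 𝟘
    right = trans (sym (·-· (at Z i) 2 ζ)) (trans (cong (2 ·_) (exponent Z i)) (·-𝟘 2))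

  Z⊆B : ∀ {h} → h ∈ Z → h ∈ B
  Z⊆B h∈ = let k , e = t⊕Z⊆b 0 h∈ in k , trans (sym (⊕-identityˡ _)) e

  b∼ : ∀ i → b i ∼⟨ Z ⟩ (i * μ) · g
  b∼ i = ∼-trans Z (∼-⊕∈ Z (i , refl)) (∼-trans Z (∼-· Z i t∼μ·g) (∼-refl Z (·-· g i μ)))

  order-B : HasOrder B g μ
  order-B = record { order≢0 = μ≢0 ; k·g∈ = μ·g∈ ; minimal = minimal′ }
    where
    μ·g∈ : μ · g ∈ B
    μ·g∈ = let h , h∈ , e = ∼-sym Z t∼μ·g
               k , e′ = t⊕Z⊆b 1 h∈ in k , trans e (trans (cong (_⊕ h) (sym (1· t))) e′)
    minimal′ : ∀ {d} → d · g ∈ B → μ ∣ d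
    minimal′ {d} (i , e) with free order-2μ (∼-trans Z (∼-refl Z e) (b∼ i))
    ... | cong-by u v e′ = ∣m+n∣n⇒∣m (divides (i + v * 2) (trans e′ (lem i v μ))) (divides (u * 2) (sym (*-assoc u 2 μ)))
      where
      lem : ∀ i v μ → i * μ + v * (2 * μ) ≡ (i + v * 2) * μ
      lem = solve-∀
      ∣m+n∣n⇒∣m : ∀ {k m n} → k ∣ m + n → k ∣ n → k ∣ m
      ∣m+n∣n⇒∣m {k} {m} {n} p q = ∣m+n∣m⇒∣n (subst (k ∣_) (+-comm m n) p) q

  C : Enumeration
  C = extend B g μ order-B

  m : ℕ
  m = μ * ζ

  m≢0 : NonZero m
  m≢0 = m*n≢0 μ ζ {{μ≢0}} {{ζ≢0}}

  size-C : size C ≡ 2 * m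
  size-C = lem μ ζ
    where
    lem : ∀ μ ζ → μ * (2 * ζ) ≡ 2 * (μ * ζ)
    lem = solve-∀

  c : ℕ → Fin n
  c = at C

  open Extension B g μ order-B using (at⁺-digits)

  c-digits : ∀ j l → j < μ → c (j + l * μ) ≡ j · g ⊕ b l
  c-digits = at⁺-digits

  instance
    μ-nonZero : NonZero μ
    μ-nonZero = μ≢0

  c-shift : ∀ i u → c (i + u * m) ≡ c i ⊕ u · t
  c-shift i u = begin
    c (i + u * m)                            ≡⟨ cong c (lem (i % μ) (i / μ) i (m≡m%n+[m/n]*n i μ)) ⟩
    c (i % μ + (i / μ + u * ζ) * μ)          ≡⟨ c-digits (i % μ) (i / μ + u * ζ) (m%n<n i μ) ⟩
    (i % μ) · g ⊕ b (i / μ + u * ζ)          ≡⟨ cong ((i % μ) · g ⊕_) (b-shift (i / μ) u) ⟩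
    (i % μ) · g ⊕ (b (i / μ) ⊕ u · t)        ≡⟨ ⊕-assoc _ _ _ ⟨
    c i ⊕ u · t                              ∎
    where
    open ≡-Reasoning
    lem′ : ∀ r q u μ ζ → r + q * μ + u * (μ * ζ) ≡ r + (q + u * ζ) * μ
    lem′ = solve-∀
    lem : ∀ r q i → i ≡ r + q * μ → i + u * m ≡ r + (q + u * ζ) * μ
    lem r q i refl = lem′ r q u μ ζ

  c∼ : ∀ i → c i ∼⟨ Z ⟩ i · g
  c∼ i = ∼-trans Z (∼-⊕ Z (∼-refl Z refl) (b∼ (i / μ)))
    (∼-refl Z (trans (sym (·-+ g (i % μ) (i / μ * μ))) (cong (_· g) (sym (m≡m%n+[m/n]*n i μ)))))

  c-surjective : ∀ x → x ∈ C
  c-surjective x = let j , h , _ , h∈ , e = split-extend Z g M order-g (covers x) in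
    subst (_∈ C) (sym e) (∈-extend B g μ order-B j (Z⊆B h∈))

  abstract
    pos : Fin n → ℕ
    pos x = proj₁ (c-surjective x)

    c-pos : ∀ x → c (pos x) ≡ x
    c-pos x = sym (proj₂ (c-surjective x))

  N : Fin n → Fin n
  N x = c (suc (pos x))

  N-c : ∀ i → N (c i) ≡ c (suc i)
  N-c i = at-cong C (mod-+ˡ 1 (at-injective C (c-pos (c i))))

  N-injective : ∀ {x y} → N x ≡ N y → x ≡ y
  N-injective {x} {y} e = trans (sym (c-pos x)) (trans (at-cong C (mod-cancelˡ 1 (at-injective C e))) (c-pos y))

  N-surjective : ∀ x → ∃ λ y → N y ≡ x
  N-surjective x = c (pos x + (size C ∸ 1)) , trans (N-c _) (trans
    (cong c (trans (sym (+-suc (pos x) (size C ∸ 1))) (cong (pos x +_) (suc-pred (size C) {{size≢0 C}}))))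
    (trans (at-cong C (subst (λ k → pos x + k ≡ pos x [mod size C ]) (*-identityˡ (size C)) (mod-multiple (pos x) 1))) (c-pos x)))

  c-⊕t : ∀ x → c (pos x + 1 * m) ≡ x ⊕ t
  c-⊕t x = trans (c-shift (pos x) 1) (cong₂ _⊕_ (c-pos x) (1· t))

  N-⊕t : ∀ x → N (x ⊕ t) ≡ N x ⊕ t
  N-⊕t x = trans (cong N (sym (c-⊕t x))) (trans (N-c (pos x + 1 * m)) (trans (c-shift (suc (pos x)) 1) (cong (N x ⊕_) (1· t))))

  N∼ : ∀ x → N x ∼⟨ Z ⟩ g ⊕ x
  N∼ x = ∼-trans Z (c∼ (suc (pos x))) (∼-⊕ Z (∼-refl Z refl) (∼-trans Z (∼-sym Z (c∼ (pos x))) (∼-refl Z (c-pos x))))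

  -- No carry occurs here, so the step is g exactly and not merely modulo Z.
  N-step : ∀ j {h} → suc j < μ → h ∈ B → N (j · g ⊕ h) ≡ g ⊕ (j · g ⊕ h)
  N-step j lt (l , refl) = trans (cong N (sym (c-digits j l (<-trans (n<1+n j) lt))))
    (trans (N-c (j + l * μ)) (trans (c-digits (suc j) l lt) (⊕-assoc _ _ _)))

  c⊕c∼ : ∀ i → c i ⊕ c (suc i) ∼⟨ Z ⟩ (1 + 2 * i) · g
  c⊕c∼ i = ∼-trans Z (∼-⊕ Z (c∼ i) (c∼ (suc i))) (∼-refl Z (trans (sym (·-+ g i (suc i))) (cong (_· g) (lem i))))
    where
    lem : ∀ i → i + suc i ≡ 1 + 2 * i
    lem = solve-∀

  -- Modulo Z, consecutive elements sum to an odd multiple of g and doubles are even multiples; g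
  -- has even order 2μ.
  sum≢double : ∀ x w → x ⊕ N x ≢ 2 · w
  sum≢double x w e = odd≢even-mod {μ} {pos x} {pos w} (free order-2μ (∼-trans Z (∼-sym Z (c⊕c∼ (pos x))) (∼-trans Z
    (∼-refl Z (trans (cong (_⊕ N x) (c-pos x)) (trans e (cong (2 ·_) (sym (c-pos w))))))
    (∼-trans Z (∼-· Z 2 (c∼ (pos w))) (∼-refl Z (·-· g 2 (pos w)))))))

  ⊕·t : ∀ u x y → x ⊕ u · t ≡ y → x ≡ y ⊎ x ≡ y ⊕ t
  ⊕·t u x y e with parity u
  ... | inj₁ (w , refl) = inj₁ (trans (sym (trans (cong (x ⊕_) (·t-cong {2 * w} {0} (cong-by 0 w (trans (+-identityʳ _) (*-comm 2 w))))) (⊕-identityʳ x))) e)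
  ... | inj₂ (w , refl) = inj₂ (trans (sym (trans (⊕-assoc x t t) (trans (cong (x ⊕_) (trans (sym (2· t)) 2t≡𝟘)) (⊕-identityʳ x))))
        (cong (_⊕ t) (trans (cong (x ⊕_) (sym (odd·-involution (w , refl) 2t≡𝟘))) e)))

  c-mod-m : ∀ {i i′} → i ≡ i′ [mod m ] → c i ≡ c i′ ⊎ c i ≡ c i′ ⊕ t
  c-mod-m {i} {i′} (cong-by u v e) = ⊕·t (u + v) (c i) (c i′) (begin
    c i ⊕ (u + v) · t         ≡⟨ cong (c i ⊕_) (·-+ t u v) ⟩
    c i ⊕ (u · t ⊕ v · t)     ≡⟨ ⊕-assoc _ _ _ ⟨
    (c i ⊕ u · t) ⊕ v · t     ≡⟨ cong (_⊕ v · t) (trans (sym (c-shift i u)) (trans (cong c e) (c-shift i′ v))) ⟩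
    (c i′ ⊕ v · t) ⊕ v · t    ≡⟨ ⊕-assoc _ _ _ ⟩
    c i′ ⊕ (v · t ⊕ v · t)    ≡⟨ cong (c i′ ⊕_) (trans (sym (·-+ t v v)) (·t-cong (cong-by 0 v (lem v)))) ⟩
    c i′ ⊕ 𝟘                  ≡⟨ ⊕-identityʳ _ ⟩
    c i′                      ∎)
    where
    open ≡-Reasoning
    lem : ∀ v → v + v + 0 * 2 ≡ 0 + v * 2
    lem = solve-∀

  -- The sum modulo Z fixes the low digit, hence whether a carry occurs. Without a carry it fixes 2
  -- · c i, hence c i up to t. With a carry, the t-parts of the two b-terms always sum to t, and
  -- harmony of Z fixes the index modulo m.
  c-sum : ∀ {i i′} → c i ⊕ c (suc i) ≡ c i′ ⊕ c (suc i′) → c i ≡ c i′ ⊎ c i ≡ c i′ ⊕ t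
  c-sum {i} {i′} e = cases (suc-digits μ i) (suc-digits μ i′)
    where
    i≡i′ : i ≡ i′ [mod μ ]
    i≡i′ = mod-unscale 2 (mod-cancelˡ 1 (free order-2μ (∼-trans Z (∼-sym Z (c⊕c∼ i)) (∼-trans Z (∼-refl Z e) (c⊕c∼ i′)))))
    same : i % μ ≡ i′ % μ
    same = mod-%-unique i≡i′
    plain : ∀ i → suc i % μ ≡ suc (i % μ) → suc i / μ ≡ i / μ → c i ⊕ c (suc i) ≡ g ⊕ 2 · c i
    plain i p q = trans (cong (c i ⊕_) (trans (cong₂ (λ a l → a · g ⊕ b l) p q) (⊕-assoc _ _ _)))
      (trans (solve 2 (λ x g → (x :⊕ (g :⊕ x)) ⊜ (g :⊕ (x :⊕ x))) refl (c i) g) (cong (g ⊕_) (sym (2· (c i)))))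
    carry : ∀ i → suc i % μ ≡ 0 → suc i / μ ≡ suc (i / μ) →
            c i ⊕ c (suc i) ≡ ((i % μ) · g ⊕ ((1 + 2 * (i / μ)) · t)) ⊕ (at Z (i / μ) ⊕ at Z (suc (i / μ)))
    carry i p q = trans (cong (c i ⊕_) (trans (cong₂ (λ a l → a · g ⊕ b l) p q) (⊕-identityˡ _)))
      (trans (solve 5 (λ x u v y w → ((x :⊕ (u :⊕ v)) :⊕ (y :⊕ w)) ⊜ ((x :⊕ (u :⊕ y)) :⊕ (v :⊕ w))) refl
               ((i % μ) · g) ((i / μ) · t) (at Z (i / μ)) (suc (i / μ) · t) (at Z (suc (i / μ))))
             (cong (λ y → ((i % μ) · g ⊕ y) ⊕ (at Z (i / μ) ⊕ at Z (suc (i / μ))))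
               (trans (sym (·-+ t (i / μ) (suc (i / μ)))) (cong (_· t) (lem (i / μ))))))
      where
      lem : ∀ l → l + suc l ≡ 1 + 2 * l
      lem = solve-∀
    t-constant : ∀ l → (1 + 2 * l) · t ≡ t
    t-constant l = odd·-involution (l , refl) 2t≡𝟘
    cases : _ → _ → c i ≡ c i′ ⊎ c i ≡ c i′ ⊕ t
    cases (inj₁ (_ , p , q)) (inj₁ (_ , p′ , q′)) =
      double-injective (⊕-cancelˡ g _ _ (trans (sym (plain i p q)) (trans e (plain i′ p′ q′))))
    cases (inj₂ (_ , p , q)) (inj₂ (_ , p′ , q′)) = c-mod-m (mod-digits μ same (harmonious core
      (⊕-cancelˡ ((i % μ) · g ⊕ t) _ _ (begin
        ((i % μ) · g ⊕ t) ⊕ (at Z (i / μ) ⊕ at Z (suc (i / μ)))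
          ≡⟨ cong (λ y → ((i % μ) · g ⊕ y) ⊕ (at Z (i / μ) ⊕ at Z (suc (i / μ)))) (t-constant (i / μ)) ⟨
        ((i % μ) · g ⊕ (1 + 2 * (i / μ)) · t) ⊕ (at Z (i / μ) ⊕ at Z (suc (i / μ)))
          ≡⟨ trans (sym (carry i p q)) (trans e (carry i′ p′ q′)) ⟩
        ((i′ % μ) · g ⊕ (1 + 2 * (i′ / μ)) · t) ⊕ (at Z (i′ / μ) ⊕ at Z (suc (i′ / μ)))
          ≡⟨ cong₂ (λ r y → (r · g ⊕ y) ⊕ (at Z (i′ / μ) ⊕ at Z (suc (i′ / μ)))) (sym same) (t-constant (i′ / μ)) ⟩
        ((i % μ) · g ⊕ t) ⊕ (at Z (i′ / μ) ⊕ at Z (suc (i′ / μ))) ∎))))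
      where open ≡-Reasoning
    cases (inj₁ (lt , _)) (inj₂ (eq , _)) = contradiction (trans (cong suc same) eq) (<⇒≢ lt)
    cases (inj₂ (eq , _)) (inj₁ (lt , _)) = contradiction (trans (cong suc (sym same)) eq) (<⇒≢ lt)

  N-sum : ∀ {x y} → x ⊕ N x ≡ y ⊕ N y → x ≡ y ⊎ x ≡ y ⊕ t
  N-sum {x} {y} e = subst₂ (λ u v → u ≡ v ⊎ u ≡ v ⊕ t) (c-pos x) (c-pos y)
    (c-sum (trans (cong (_⊕ N x) (c-pos x)) (trans e (cong (_⊕ N y) (sym (c-pos y))))))

-- Cut points in the cyclic quotient ℤ/2μ

mod-unique-near : ∀ {M a b} .{{_ : NonZero M}} → a < b + M → b < a + M → a ≡ b [mod M ] → a ≡ b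
mod-unique-near {M} {a} {b} a<b+M b<a+M p with ≤-total a b
... | inj₁ a≤b = mod-unique-≤ a≤b b<a+M p
... | inj₂ b≤a = sym (mod-unique-≤ b≤a a<b+M (mod-sym p))

-- The criterion for ε: (2 - ε) * μ must not be 2 modulo 3. The choice ε = 0 fails exactly when μ is
-- 1 modulo 3, and then ε = 1 works.
3x≢3y+2 : ∀ x y → 3 * x ≢ 3 * y + 2
3x≢3y+2 x y e = contradiction (mod-unique {3} {0} {2} (s≤s z≤n) ≤-refl
    (cong-by x y (trans (*-comm x 3) (trans e (lem y))))) λ ()
  where
  lem : ∀ y → 3 * y + 2 ≡ 2 + y * 3
  lem = solve-∀

thirds : ∀ n → ∃ λ q → n ≡ 3 * q ⊎ n ≡ 1 + 3 * q ⊎ n ≡ 2 + 3 * q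
thirds zero = 0 , inj₁ refl
thirds (suc n) with thirds n
... | q , inj₁ refl        = q , inj₂ (inj₁ refl)
... | q , inj₂ (inj₁ refl) = q , inj₂ (inj₂ refl)
... | q , inj₂ (inj₂ refl) = suc q , inj₁ (lem q)
  where
  lem : ∀ q → 3 + 3 * q ≡ 3 * suc q
  lem = solve-∀

-- Separates the columns of early and late seeds.
offset : ∀ μ → ∃ λ ε → ε ≤ 1 × (∀ a → 3 * a + 2 + ε * μ ≢ 2 * μ)
offset μ with thirds μ
... | q , inj₁ refl = 0 , z≤n , λ a e → 3x≢3y+2 (2 * q) a (sym (trans (sym (+-identityʳ _)) (trans e (lem q))))
  where
  lem : ∀ q → 2 * (3 * q) ≡ 3 * (2 * q)
  lem = solve-∀
... | q , inj₂ (inj₁ refl) = 1 , ≤-refl , λ a e → 3x≢3y+2 (a + q + 1) (2 * q) (trans (sym (lem a q)) (trans e (lem′ q)))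
  where
  lem : ∀ a q → 3 * a + 2 + 1 * (1 + 3 * q) ≡ 3 * (a + q + 1)
  lem = solve-∀
  lem′ : ∀ q → 2 * (1 + 3 * q) ≡ 3 * (2 * q) + 2
  lem′ = solve-∀
... | q , inj₂ (inj₂ refl) = 0 , z≤n , λ a e → 3x≢3y+2 a (2 * q) (+-cancelʳ-≡ 2 _ _ (trans (sym (+-identityʳ _)) (trans e (lem q))))
  where
  lem : ∀ q → 2 * (2 + 3 * q) ≡ 3 * (2 * q) + 2 + 2
  lem = solve-∀

-- In ℤ/2μ, the cut point for the difference 2j is j when 2j < μ, and j − 1 + εμ otherwise;
-- in the late case the cell of the near-diagonal is the one removed.
data Placement (μ : ℕ) : ℕ → Set where
  early : ∀ {j} → 2 * j < μ → Placement μ j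
  late  : ∀ {j} → μ ≤ 2 * suc j → suc j < μ → Placement μ (suc j)

place : ∀ {μ} j → j < μ → Placement μ j
place {μ} j j<μ with 2 * j <? μ
... | yes 2j<μ = early 2j<μ
place {μ} zero    j<μ | no 2j≮μ = contradiction j<μ 2j≮μ
place {μ} (suc j) j<μ | no 2j≮μ = late (≮⇒≥ 2j≮μ) j<μ

module Degrees {μ : ℕ} {{_ : NonZero (2 * μ)}} {ε : ℕ} (ε≤1 : ε ≤ 1) (avoid : ∀ a → 3 * a + 2 + ε * μ ≢ 2 * μ) where

  isLate : ∀ {j} → Placement μ j → Bool
  isLate (early _)  = false
  isLate (late _ _) = true

  -- Multiples of g, modulo Z, for the cut point and for the row, column and symbol of the removed
  -- cell. The last three are j, 3j, 4j for early j, and j + εμ, 3j - 1 + εμ, 4j - 1 + 2εμ for late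
  -- j.
  seedDeg rowDeg colDeg sumDeg : ∀ {j} → Placement μ j → ℕ
  seedDeg {j}     (early _)  = j
  seedDeg {suc j} (late _ _) = j + ε * μ
  rowDeg p = if isLate p then suc (seedDeg p) else seedDeg p
  colDeg {j} p = seedDeg p + 2 * j
  sumDeg p = rowDeg p + colDeg p

  private
    εμ≤μ : ε * μ ≤ μ
    εμ≤μ = subst (ε * μ ≤_) (*-identityˡ μ) (*-monoˡ-≤ μ ε≤1)

    early<late : ∀ j k → 2 * j < μ → μ ≤ 2 * suc k → j ≤ k
    early<late j k p q = ≤-pred (*-cancelˡ-< 2 j (suc k) (<-≤-trans p q))

    rowDeg< : ∀ {j} (p : Placement μ j) → rowDeg p < 2 * μ
    rowDeg< {j} (early p) = <-≤-trans (≤-<-trans (m≤m+n j (j + 0)) p) (m≤m+n μ _)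
    rowDeg< {suc j} (late _ j<μ) = subst (suc j + ε * μ <_) (cong (μ +_) (sym (+-identityʳ μ))) (+-mono-<-≤ j<μ εμ≤μ)

    -- Late indices lie between μ/2 and μ, so three or four times their difference stays below 2μ
    -- and congruence becomes equality.
    3-near : ∀ j k → suc j < μ → μ ≤ 2 * suc k → 3 * suc j < 3 * suc k + 2 * μ
    3-near j k p q = <-≤-trans (*-monoʳ-< 3 p) (+-monoˡ-≤ (2 * μ) (≤-trans q (*-monoˡ-≤ (suc k) (n≤1+n 2))))

    4-near : ∀ j k → suc j < μ → μ ≤ 2 * suc k → 4 * suc j < 4 * suc k + 2 * μ
    4-near j k p q = <-≤-trans (*-monoʳ-< 4 p) (subst₂ _≤_ (lem μ) (cong (_+ 2 * μ) (sym (lem′ (suc k)))) (+-monoˡ-≤ (2 * μ) (*-monoʳ-≤ 2 q)))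
      where
      lem : ∀ μ → 2 * μ + 2 * μ ≡ 4 * μ
      lem = solve-∀
      lem′ : ∀ k → 4 * k ≡ 2 * (2 * k)
      lem′ = solve-∀

    colDeg-late : ∀ j → 1 + (j + ε * μ + 2 * suc j) ≡ 3 * suc j + ε * μ
    colDeg-late j = lem j (ε * μ)
      where
      lem : ∀ j x → 1 + (j + x + 2 * suc j) ≡ 3 * suc j + x
      lem = solve-∀

    sumDeg-late : ∀ j → 1 + (suc (j + ε * μ) + (j + ε * μ + 2 * suc j)) ≡ 4 * suc j + 2 * (ε * μ)
    sumDeg-late j = lem j (ε * μ)
      where
      lem : ∀ j x → 1 + (suc (j + x) + (j + x + 2 * suc j)) ≡ 4 * suc j + 2 * x
      lem = solve-∀

    near : ∀ a b {x a′ b′} → 1 + a′ ≡ a + x → 1 + b′ ≡ b + x → a < b + 2 * μ → a′ < b′ + 2 * μ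
    near a b {x} {a′} {b′} p q lt = ≤-pred (subst₂ (λ u v → u < v) (sym p)
      (trans (lem b (2 * μ) x) (cong (_+ 2 * μ) (sym q))) (+-monoˡ-< x lt))
      where
      lem : ∀ b m x → b + m + x ≡ b + x + m
      lem = solve-∀

    same : ∀ a b {x a′ b′} → 1 + a′ ≡ a + x → 1 + b′ ≡ b + x → a′ ≡ b′ → a ≡ b
    same a b {x} p q e = +-cancelʳ-≡ x _ _ (trans (sym p) (trans (cong suc e) q))

    -- The late column exceeds the early one by 3a + 2 + εμ, which is positive and below 4μ. Only
    -- the value 2μ remains, and `avoid` excludes it.
    early-late-col : ∀ j k → 2 * j < μ → μ ≤ 2 * suc k → suc k < μ →
                     ¬ (j + 2 * j ≡ k + ε * μ + 2 * suc k [mod 2 * μ ])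
    early-late-col j k p q k<μ c = avoid-q (mod-≤ le c)
      where
      a : ℕ
      a = k ∸ j
      k≡ : k ≡ j + a
      k≡ = sym (m+[n∸m]≡n (early<late j k p q))
      lem : ∀ j a x → (j + a) + x + 2 * suc (j + a) ≡ (j + 2 * j) + (3 * a + 2 + x)
      lem = solve-∀
      col≡ : k + ε * μ + 2 * suc k ≡ (j + 2 * j) + (3 * a + 2 + ε * μ)
      col≡ = trans (cong (λ k → k + ε * μ + 2 * suc k) k≡) (lem j a (ε * μ))
      le : j + 2 * j ≤ k + ε * μ + 2 * suc k
      le = subst (j + 2 * j ≤_) (sym col≡) (m≤m+n _ _)
      avoid-q : ¬ (∃ λ r → k + ε * μ + 2 * suc k ≡ (j + 2 * j) + r * (2 * μ))
      avoid-q (r , e) with +-cancelˡ-≡ (j + 2 * j) _ _ (trans (sym col≡) e)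
      avoid-q (zero  , e) | e′ = contradiction (trans (sym e′) (lem₀ a (ε * μ))) λ ()
        where
        lem₀ : ∀ a x → 3 * a + 2 + x ≡ suc (suc (3 * a + x))
        lem₀ = solve-∀
      avoid-q (suc zero , e) | e′ = avoid a (trans e′ (*-identityˡ (2 * μ)))
      avoid-q (suc (suc r) , e) | e′ = <⇒≱ bound (≤-trans (m≤m+n (4 * μ) (r * (2 * μ))) (≤-reflexive (trans (lem₄ r μ) (sym e′))))
        where
        lem₄ : ∀ r μ → 4 * μ + r * (2 * μ) ≡ suc (suc r) * (2 * μ)
        lem₄ = solve-∀
        bound : 3 * a + 2 + ε * μ < 4 * μ
        bound = subst (3 * a + 2 + ε * μ <_) (lem₅ μ) (+-mono-<-≤ 
            (≤-trans (≤-reflexive (lem₆ a)) (*-monoʳ-≤ 3 (≤-trans (s≤s (m∸n≤m k j)) (<⇒≤ k<μ)))) εμ≤μ)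
          where
          lem₅ : ∀ μ → 3 * μ + μ ≡ 4 * μ
          lem₅ = solve-∀
          lem₆ : ∀ a → suc (3 * a + 2) ≡ 3 * suc a
          lem₆ = solve-∀

    -- Parity separates them: removing the near-diagonal cell makes late symbols odd, while early
    -- ones are even.
    early-late-sum : ∀ j k → ¬ (j + (j + 2 * j) ≡ suc (k + ε * μ) + (k + ε * μ + 2 * suc k) [mod 2 * μ ])
    early-late-sum j k c = odd≢even-mod {μ} {2 * k + ε * μ + 1} {2 * j}
      (subst₂ (λ u v → u ≡ v [mod 2 * μ ]) (lem k (ε * μ)) (lem′ j) (mod-sym c))
      where
      lem : ∀ k x → suc (k + x) + (k + x + 2 * suc k) ≡ 1 + 2 * (2 * k + x + 1)
      lem = solve-∀
      lem′ : ∀ j → j + (j + 2 * j) ≡ 2 * (2 * j)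
      lem′ = solve-∀

    early-bound : ∀ j → 2 * j < μ → 2 * (2 * j) < 2 * μ
    early-bound _ = *-monoʳ-< 2

  -- Early rows lie below μ/2, late rows at or above it, and none reaches 2μ.
  row-injective : ∀ {j k} (p : Placement μ j) (q : Placement μ k) → rowDeg p ≡ rowDeg q [mod 2 * μ ] → j ≡ k
  row-injective p q c = cases p q (mod-unique (rowDeg< p) (rowDeg< q) c)
    where
    cases : ∀ {j k} (p : Placement μ j) (q : Placement μ k) → rowDeg p ≡ rowDeg q → j ≡ k
    cases (early _) (early _) e = e
    cases (late _ _) (late _ _) e = +-cancelʳ-≡ (ε * μ) _ _ e
    cases (early {j} p) (late {k} q _) e =
      contradiction (early<late j k p q) (<⇒≱ (≤-trans (m≤m+n (suc k) (ε * μ)) (≤-reflexive (sym e))))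
    cases (late {k} q _) (early {j} p) e =
      contradiction (early<late j k p q) (<⇒≱ (≤-trans (m≤m+n (suc k) (ε * μ)) (≤-reflexive e)))

  col-injective : ∀ {j k} (p : Placement μ j) (q : Placement μ k) → colDeg p ≡ colDeg q [mod 2 * μ ] → j ≡ k
  col-injective {j} {k} (early p) (early q) c = *-cancelˡ-≡ j k 3 (mod-unique (bound j p) (bound k q) c)
    where
    bound : ∀ j → 2 * j < μ → 3 * j < 2 * μ
    bound j p = ≤-<-trans (≤-trans (*-monoˡ-≤ j (n≤1+n 3)) (≤-reflexive (lem j))) (early-bound j p)
      where
      lem : ∀ j → 4 * j ≡ 2 * (2 * j)
      lem = solve-∀
  col-injective {suc j} {suc k} (late p j<μ) (late q k<μ) c = *-cancelˡ-≡ (suc j) (suc k) 3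
    (same (3 * suc j) (3 * suc k) (colDeg-late j) (colDeg-late k) (mod-unique-near
      (near (3 * suc j) (3 * suc k) (colDeg-late j) (colDeg-late k) (3-near j k j<μ q))
      (near (3 * suc k) (3 * suc j) (colDeg-late k) (colDeg-late j) (3-near k j k<μ p)) c))
  col-injective (early {j} p) (late {k} q k<μ) c = contradiction c (early-late-col j k p q k<μ)
  col-injective (late {k} q k<μ) (early {j} p) c = contradiction (mod-sym c) (early-late-col j k p q k<μ)

  sum-injective : ∀ {j k} (p : Placement μ j) (q : Placement μ k) → sumDeg p ≡ sumDeg q [mod 2 * μ ] → j ≡ k
  sum-injective {j} {k} (early p) (early q) c = *-cancelˡ-≡ j k 4 (mod-unique (bound j p) (bound k q) c)
    where
    bound : ∀ j → 2 * j < μ → 4 * j < 2 * μ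
    bound j p = subst (_< 2 * μ) (lem j) (early-bound j p)
      where
      lem : ∀ j → 2 * (2 * j) ≡ 4 * j
      lem = solve-∀
  sum-injective {suc j} {suc k} (late p j<μ) (late q k<μ) c = *-cancelˡ-≡ (suc j) (suc k) 4
    (same (4 * suc j) (4 * suc k) (sumDeg-late j) (sumDeg-late k) (mod-unique-near
      (near (4 * suc j) (4 * suc k) (sumDeg-late j) (sumDeg-late k) (4-near j k j<μ q))
      (near (4 * suc k) (4 * suc j) (sumDeg-late k) (sumDeg-late j) (4-near k j k<μ p)) c))
  sum-injective (early {j} p) (late {k} q _) c = contradiction c (early-late-sum j k)
  sum-injective (late {k} q _) (early {j} p) c = contradiction (mod-sym c) (early-late-sum j k)

-- The colouring with n + 2 classes

module Colouring {n} (G : FiniteAbelianGroup n) (involution : Involutions.UniqueInvolution G)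
                 (F : Frames.Frame G involution) where
  open Additive G
  open Extensions G
  open Cores G
  open Cycles G involution F

  instance
    m-nonZero : NonZero m
    m-nonZero = m≢0

    2μ-nonZero : NonZero (2 * μ)
    2μ-nonZero = order≢0 order-2μ

  -- The half turn of the cycle c that contains position i.
  half : ℕ → Bool
  half i = isOdd (i / m)

  half-cong : ∀ {i i′} → i ≡ i′ [mod size C ] → half i ≡ half i′
  half-cong {i} {i′} (cong-by u v e) = trans (sym (period i u)) (trans (cong half e) (period i′ v))
    where
    period : ∀ i u → half (i + u * size C) ≡ half i
    period i u = trans (cong half (cong (i +_) (trans (cong (u *_) size-C) (sym (*-assoc u 2 m)))))
      (trans (cong isOdd (/-shift m i (u * 2))) (isOdd-2+ u (i / m)))

  half-+m : ∀ i → half (i + 1 * m) ≡ not (half i)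
  half-+m i = cong isOdd (trans (/-shift m i 1) (+-comm (i / m) 1))

  half-suc : ∀ i → half (suc i) ≢ half i → ∃ λ q → suc i ≡ q * m
  half-suc i change with suc-digits m i
  ... | inj₁ (_ , _ , q) = contradiction (cong isOdd q) change
  ... | inj₂ (_ , r , _) = suc i / m , trans (m≡m%n+[m/n]*n (suc i) m) (cong (_+ suc i / m * m) r)

  -- A natural number congruent to -(pos s + 1) modulo m; added to positions, it puts a boundary of
  -- half turns directly after s.
  rotation : Fin n → ℕ
  rotation s = pos s * (m ∸ 1) + (m ∸ 1)

  -- side s splits the cycle into the two half turns starting just after s and s ⊕ t.
  side : Fin n → Fin n → Bool
  side s x = half (pos x + rotation s)

  pos+rotation : ∀ s → suc (pos s + rotation s) ≡ suc (pos s) * m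
  pos+rotation s = trans (lem (pos s) (m ∸ 1)) (cong (suc (pos s) *_) (suc-pred m))
    where
    lem : ∀ p m → suc (p + (p * m + m)) ≡ suc p * suc m
    lem = solve-∀

  side-⊕t : ∀ s x → side s (x ⊕ t) ≡ not (side s x)
  side-⊕t s x = trans (half-cong (mod-+ (at-injective C (trans (c-pos (x ⊕ t)) (sym (c-⊕t x)))) (mod-refl {b = rotation s} refl)))
    (trans (cong half (lem (pos x) (1 * m) (rotation s))) (half-+m (pos x + rotation s)))
    where
    lem : ∀ a b c → a + b + c ≡ a + c + b
    lem = solve-∀

  -- The side changes only when the rotated index enters a multiple of m, which fixes pos x modulo m
  -- and therefore x up to t.
  side-N : ∀ s x → side s (N x) ≢ side s x → x ≡ s ⊎ x ≡ s ⊕ t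
  side-N s x change = subst₂ (λ u v → u ≡ v ⊎ u ≡ v ⊕ t) (c-pos x) (c-pos s)
      (c-mod-m (boundary (half-suc (pos x + rotation s) λ e → change (trans half-N e))))
    where
    open ≡-Reasoning
    half-N : half (pos (N x) + rotation s) ≡ half (suc (pos x + rotation s))
    half-N = half-cong (mod-+ (at-injective C (c-pos (N x))) (mod-refl {b = rotation s} refl))
    boundary : ∃ (λ q → suc (pos x + rotation s) ≡ q * m) → pos x ≡ pos s [mod m ]
    boundary (q , e) = mod-cancelʳ (suc (rotation s)) (cong-by (suc (pos s)) q (begin
      pos x + suc (rotation s) + suc (pos s) * m   ≡⟨ cong (_+ suc (pos s) * m) (trans (+-suc (pos x) _) e) ⟩
      q * m + suc (pos s) * m                      ≡⟨ +-comm (q * m) _ ⟩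
      suc (pos s) * m + q * m                      ≡⟨ cong (_+ q * m) (trans (+-suc (pos s) _) (pos+rotation s)) ⟨
      pos s + suc (rotation s) + q * m             ∎))

  ε : ℕ
  ε = proj₁ (offset μ)

  open Degrees {μ} {ε} (proj₁ (proj₂ (offset μ))) (proj₂ (proj₂ (offset μ)))

  -- Indexes 2G through `gap`: modulo Z the doubles are 2j · g with j < μ, and doubling permutes Z
  -- because ζ is odd.
  Label : Set
  Label = Fin μ × Fin ζ

  placement : (e : Label) → Placement μ (toℕ (proj₁ e))
  placement (j , _) = place (toℕ j) (Fin.toℕ<n j)

  gap : Label → Fin n
  gap (j , z) = (2 * toℕ j) · g ⊕ 2 · at Z (toℕ z)

  seed : Label → Fin n
  seed e@(_ , z) = seedDeg (placement e) · g ⊕ spread core (toℕ z)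

  kind : Label → Bool
  kind e = isLate (placement e)

  row : Bool → Fin n → Fin n
  row false x = x
  row true  x = N x

  label-injective : (D : ∀ {j} → Placement μ j → ℕ) (V : ℕ → Fin n) →
    (∀ {j k} (p : Placement μ j) (q : Placement μ k) → D p ≡ D q [mod 2 * μ ] → j ≡ k) →
    (∀ i → V i ∈ Z) → (∀ {i i′} → V i ≡ V i′ → i ≡ i′ [mod ζ ]) →
    ∀ {e e′ : Label} → D (placement e) · g ⊕ V (toℕ (proj₂ e)) ≡ D (placement e′) · g ⊕ V (toℕ (proj₂ e′)) → e ≡ e′
  label-injective D V D-injective V∈ V-injective {j , z} {j′ , z′} eq
    with Fin.toℕ-injective (D-injective (placement (j , z)) (placement (j′ , z′))
           (free order-2μ (∼-trans Z (∼-sym Z (∼-⊕∈ Z (V∈ (toℕ z)))) (∼-trans Z (∼-refl Z eq) (∼-⊕∈ Z (V∈ (toℕ z′)))))))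
  ... | refl = cong (j ,_) (at-toℕ-injective Z (at-cong Z (V-injective (⊕-cancelˡ _ _ _ eq))))

  -- In the late case N must add exactly g, so that the part in Z remains the value of `spread`. It
  -- does: (ε * μ) · g lies in B, so the low digit of the seed is j with suc j < μ, and N makes no
  -- carry.
  seed-row : ∀ e → row (kind e) (seed e) ≡ rowDeg (placement e) · g ⊕ spread core (toℕ (proj₂ e))
  seed-row e@(_ , z) = by (placement e)
    where
    ω : Fin n
    ω = spread core (toℕ z)
    by : ∀ {j} (p : Placement μ j) → row (isLate p) (seedDeg p · g ⊕ ω) ≡ rowDeg p · g ⊕ ω
    by (early _)          = refl
    by (late {j} _ j+1<μ) = trans (cong N e₁) (trans (N-step j j+1<μ (∈-⊕ B εμg∈ (Z⊆B (spread∈ core (toℕ z)))))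
        (trans (cong (g ⊕_) (sym e₁)) (sym (⊕-assoc g _ ω))))
      where
      e₁ : (j + ε * μ) · g ⊕ ω ≡ j · g ⊕ ((ε * μ) · g ⊕ ω)
      e₁ = trans (cong (_⊕ ω) (·-+ g j (ε * μ))) (⊕-assoc _ _ ω)
      εμg∈ : (ε * μ) · g ∈ B
      εμg∈ = subst (_∈ B) (·-· g ε μ) (∈-· B ε (k·g∈ order-B))

  seed-col : ∀ e → seed e ⊕ gap e ≡
             colDeg (placement e) · g ⊕ (spread core (toℕ (proj₂ e)) ⊕ 2 · at Z (toℕ (proj₂ e)))
  seed-col e@(j , z) = trans (⊕-interchange _ _ _ _)
    (cong (_⊕ (spread core (toℕ z) ⊕ 2 · at Z (toℕ z))) (sym (·-+ g (seedDeg (placement e)) (2 * toℕ j))))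

  seed-sum : ∀ e → row (kind e) (seed e) ⊕ (seed e ⊕ gap e) ≡
             sumDeg (placement e) · g ⊕ 2 · (spread core (toℕ (proj₂ e)) ⊕ at Z (toℕ (proj₂ e)))
  seed-sum e@(_ , z) = trans (cong₂ _⊕_ (seed-row e) (seed-col e)) (trans
    (solve 4 (λ r w c a → ((r :⊕ w) :⊕ (c :⊕ (w :⊕ a))) ⊜ ((r :⊕ c) :⊕ ((w :⊕ w) :⊕ a))) refl
      (rowDeg (placement e) · g) ω (colDeg (placement e) · g) (2 · a))
    (cong₂ _⊕_ (sym (·-+ g (rowDeg (placement e)) (colDeg (placement e))))
      (trans (cong (_⊕ 2 · a) (sym (2· ω))) (sym (·-⊕ ω a 2)))))
    where
    ω = spread core (toℕ z)
    a = at Z (toℕ z)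

  seed-row-injective : ∀ {e e′} → row (kind e) (seed e) ≡ row (kind e′) (seed e′) → e ≡ e′
  seed-row-injective {e} {e′} eq = label-injective rowDeg _ row-injective (spread∈ core) (spread-injective₀ core)
    (trans (sym (seed-row e)) (trans eq (seed-row e′)))

  seed-col-injective : ∀ {e e′} → seed e ⊕ gap e ≡ seed e′ ⊕ gap e′ → e ≡ e′
  seed-col-injective {e} {e′} eq = label-injective colDeg (λ i → spread core i ⊕ 2 · at Z i) col-injective
    (λ i → ∈-⊕ Z (spread∈ core i) (∈-· Z 2 (i , refl))) (spread-injective₂ core)
    (trans (sym (seed-col e)) (trans eq (seed-col e′)))

  seed-sum-injective : ∀ {e e′} → row (kind e) (seed e) ⊕ (seed e ⊕ gap e)
                                ≡ row (kind e′) (seed e′) ⊕ (seed e′ ⊕ gap e′) → e ≡ e′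
  seed-sum-injective {e} {e′} eq = label-injective sumDeg (λ i → 2 · (spread core i ⊕ at Z i)) sum-injective
    (λ i → ∈-· Z 2 (sum∈ i)) (λ {i} {i′} e → spread-injective₁ core (2·-injective Z odd-ζ (sum∈ i) (sum∈ i′) e))
    (trans (sym (seed-sum e)) (trans eq (seed-sum e′)))
    where
    sum∈ : ∀ i → spread core i ⊕ at Z i ∈ Z
    sum∈ i = ∈-⊕ Z (spread∈ core i) (i , refl)

  gap-label : ∀ w {d} → d ∼⟨ Z ⟩ (2 * w) · g → ∃ λ e → d ≡ gap e
  gap-label w {d} d∼ = label (∼-trans Z d∼ (cofree order-2μ (mod-scale 2 (mod-sym (mod-% w)))))
    where
    halved : ∀ {h} → (∃ λ h′ → h′ ∈ Z × 2 · h′ ≡ h) → ∃ λ (z : Fin ζ) → h ≡ 2 · at Z (toℕ z)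
    halved (h′ , (l , refl) , 2h′≡h) = reduce Z l , trans (sym 2h′≡h) (cong (2 ·_) (sym (at-reduce Z l)))
    label : d ∼⟨ Z ⟩ (2 * (w % μ)) · g → ∃ λ e → d ≡ gap e
    label (h , h∈ , d≡) = let z , h≡ = halved (halve-∈ Z odd-ζ h∈) in
      (fromℕ< (m%n<n w μ) , z) , trans d≡ (cong₂ _⊕_ (cong (λ k → (2 * k) · g) (sym (Fin.toℕ-fromℕ< (m%n<n w μ)))) h≡)

  -- τ tells the near-diagonal from the diagonal.
  Cell : Fin n → Fin n → Bool → Fin n → Label → Set
  Cell x y τ z e = row τ z ≡ x × z ⊕ gap e ≡ y

  -- The parity of the degree of y - x decides. If it is odd, x is written as N z; replacing x by z
  -- raises the degree of the difference by one and makes it even.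
  cell : ∀ x y → ∃ λ τ → ∃ λ z → ∃ λ e → Cell x y τ z e
  cell x y = by (parity (pos (y ⊕ ⊖ x)))
    where
    x⊕[y⊖x] : ∀ x → x ⊕ (y ⊕ ⊖ x) ≡ y
    x⊕[y⊖x] x = trans (⊕-comm x _) ([x⊖y]⊕y y x)
    y⊖x∼ : ∀ {k} → pos (y ⊕ ⊖ x) ≡ k → y ⊕ ⊖ x ∼⟨ Z ⟩ k · g
    y⊖x∼ refl = ∼-trans Z (∼-refl Z (sym (c-pos (y ⊕ ⊖ x)))) (c∼ (pos (y ⊕ ⊖ x)))
    by : _ → ∃ λ τ → ∃ λ z → ∃ λ e → Cell x y τ z e
    by (inj₁ (w , eq)) = let e , d≡ = gap-label w (y⊖x∼ eq) in
      false , x , e , refl , trans (cong (x ⊕_) (sym d≡)) (x⊕[y⊖x] x)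
    by (inj₂ (w , eq)) = let e , d≡ = gap-label (suc w) y⊖z∼ in
      true , z , e , proj₂ (N-surjective x) , trans (cong (z ⊕_) (sym d≡)) (x⊕[y⊖x] z)
      where
      z = proj₁ (N-surjective x)
      lem : ∀ w → 1 + (1 + 2 * w) ≡ 2 * suc w
      lem = solve-∀
      y⊖z∼ : y ⊕ ⊖ z ∼⟨ Z ⟩ (2 * suc w) · g
      y⊖z∼ = ∼-cancelˡ Z z (∼-trans Z (∼-refl Z (trans (x⊕[y⊖x] z) (sym (x⊕[y⊖x] x))))
        (∼-trans Z (∼-⊕ Z (∼-trans Z (∼-refl Z (sym (proj₂ (N-surjective x)))) (N∼ z)) (y⊖x∼ eq))
          (∼-refl Z (trans (solve 3 (λ g z k → ((g :⊕ z) :⊕ k) ⊜ (z :⊕ (g :⊕ k))) refl g z ((1 + 2 * w) · g))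
            (cong (λ k → z ⊕ k · g) (lem w))))))

  -- The two cut points yield one doubly hit column in each of the two classes of e, and the same
  -- kind of cell is removed at both.
  Exceptional : Bool → Fin n → Label → Set
  Exceptional τ z e = kind e ≡ τ × (z ≡ seed e ⊎ z ≡ seed e ⊕ t)

  exceptional? : ∀ τ z e → Dec (Exceptional τ z e)
  exceptional? τ z e = (kind e Bool.≟ τ) ×-dec ((z Fin.≟ seed e) ⊎-dec (z Fin.≟ seed e ⊕ t))

  data Colour : Set where
    regular : Label → Bool → Colour
    extra   : Bool → Colour

  translate : Bool → Fin n → Fin n
  translate false x = x
  translate true  x = x ⊕ t

  -- The class (e , σ) takes the diagonal cells whose row is on side σ and the near-diagonal cells
  -- whose row is on the other side. Testing the row, and not z, makes the rows of the two kinds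
  -- disjoint.
  data Coloured (x y : Fin n) : Colour → Set where
    regular : ∀ {τ z e σ} → Cell x y τ z e → ¬ Exceptional τ z e → side (seed e) x xor τ ≡ σ →
              Coloured x y (regular e σ)
    extra   : ∀ {β e} → Cell x y (kind e) (translate β (seed e)) e → Coloured x y (extra β)

  colour : ∀ x y → ∃ (Coloured x y)
  colour x y = let τ , z , e , cl = cell x y in by τ z e cl (exceptional? τ z e)
    where
    by : ∀ τ z e → Cell x y τ z e → Dec (Exceptional τ z e) → ∃ (Coloured x y)
    by τ z e cl (no ordinary)               = regular e _ , regular cl ordinary refl
    by τ z e cl (yes (refl , inj₁ refl))    = extra false , extra cl
    by τ z e cl (yes (refl , inj₂ refl))    = extra true , extra cl

  Compatible : (x y x′ y′ : Fin n) → Set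
  Compatible x y x′ y′ = (x ≡ x′ → y ≡ y′) × (y ≡ y′ → x ≡ x′) × (x ⊕ y ≡ x′ ⊕ y′ → x ≡ x′ × y ≡ y′)

  -- Cells of different kinds lie in rows on different sides, share a column only at a cut point,
  -- and never share a symbol by `sum≢double`. Cells of one kind with a common symbol differ at most
  -- by t, which changes the side.
  regular-compatible : ∀ {x y x′ y′ e σ} → Coloured x y (regular e σ) → Coloured x′ y′ (regular e σ) →
                       Compatible x y x′ y′
  regular-compatible {e = e} (regular {τ} {z} (refl , refl) ordinary eq) (regular {τ′} {z′} (refl , refl) ordinary′ eq′) =
    (λ x≡x′ → proj₂ (conclude (rows τ τ′ z z′ agree x≡x′))) ,
    (λ y≡y′ → proj₁ (conclude (cols (⊕-cancelʳ _ _ _ y≡y′)))) ,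
    (λ xy≡xy′ → conclude (sums τ τ′ z z′ agree (⊕-cancelʳ (gap e) _ _
      (trans (⊕-assoc _ _ _) (trans xy≡xy′ (sym (⊕-assoc _ _ _)))))))
    where
    s : Fin n
    s = seed e
    agree : side s (row τ z) xor τ ≡ side s (row τ′ z′) xor τ′
    agree = trans eq (sym eq′)
    conclude : τ ≡ τ′ × z ≡ z′ → row τ z ≡ row τ′ z′ × z ⊕ gap e ≡ z′ ⊕ gap e
    conclude (refl , refl) = refl , refl
    b≢b-xor-true : ∀ {b b′} → b ≡ b′ → b xor false ≢ b′ xor true
    b≢b-xor-true {false} refl ()
    b≢b-xor-true {true}  refl ()
    xor-cancel : ∀ τ {b b′} → b xor τ ≡ b′ xor τ → b ≡ b′
    xor-cancel τ     {false} {false} _  = refl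
    xor-cancel τ     {true}  {true}  _  = refl
    xor-cancel false {false} {true}  ()
    xor-cancel true  {false} {true}  ()
    xor-cancel false {true}  {false} ()
    xor-cancel true  {true}  {false} ()
    rows : ∀ τ τ′ z z′ → side s (row τ z) xor τ ≡ side s (row τ′ z′) xor τ′ → row τ z ≡ row τ′ z′ → τ ≡ τ′ × z ≡ z′
    rows false false z z′ _ r = refl , r
    rows true  true  z z′ _ r = refl , N-injective r
    rows false true  z z′ a r = contradiction a (b≢b-xor-true (cong (side s) r))
    rows true  false z z′ a r = contradiction (sym a) (b≢b-xor-true (cong (side s) (sym r)))
    boundary : ∀ {z} → side s z xor false ≡ side s (N z) xor true → z ≡ s ⊎ z ≡ s ⊕ t
    boundary {z} a = side-N s z λ change → b≢b-xor-true (sym change) a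
    cols : z ≡ z′ → τ ≡ τ′ × z ≡ z′
    cols refl = by τ τ′ ordinary ordinary′ agree , refl
      where
      by : ∀ τ τ′ → ¬ Exceptional τ z e → ¬ Exceptional τ′ z e → side s (row τ z) xor τ ≡ side s (row τ′ z) xor τ′ → τ ≡ τ′
      -- At a cut point, whichever kind `kind e` names, one of the two cells in the shared column
      -- has been removed.
      clash : ∀ κ → kind e ≡ κ → ¬ Exceptional false z e → ¬ Exceptional true z e → ¬ (z ≡ s ⊎ z ≡ s ⊕ t)
      clash false κ o _ at-boundary = o (κ , at-boundary)
      clash true  κ _ o at-boundary = o (κ , at-boundary)
      by false false _ _ _ = refl
      by true  true  _ _ _ = refl
      by false true  o o′ a = contradiction (boundary a) (clash (kind e) refl o o′)
      by true  false o o′ a = contradiction (boundary (sym a)) (clash (kind e) refl o′ o)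
    not-translate : ∀ {u v} → u ≡ v ⊕ t → side s u ≢ side s v
    not-translate {v = v} refl a = Bool.not-¬ {side s v} refl (trans (sym a) (side-⊕t s v))
    sums : ∀ τ τ′ z z′ → side s (row τ z) xor τ ≡ side s (row τ′ z′) xor τ′ → row τ z ⊕ z ≡ row τ′ z′ ⊕ z′ → τ ≡ τ′ × z ≡ z′
    sums false false z z′ a r =
      [ (λ z≡z′ → refl , z≡z′) , (λ z≡z′⊕t → contradiction (xor-cancel false a) (not-translate z≡z′⊕t)) ]′
        (double-injective (trans (2· z) (trans r (sym (2· z′)))))
    sums true true z z′ a r =
      [ (λ z≡z′ → refl , z≡z′)
      , (λ z≡z′⊕t → contradiction (xor-cancel true a) (not-translate (trans (cong N z≡z′⊕t) (N-⊕t z′)))) ]′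
        (N-sum (trans (⊕-comm z _) (trans r (⊕-comm _ z′))))
    sums false true z z′ _ r = contradiction (trans (⊕-comm z′ _) (trans (sym r) (sym (2· z)))) (sum≢double z′ z)
    sums true false z z′ _ r = contradiction (trans (⊕-comm z _) (trans r (sym (2· z′)))) (sum≢double z z′)

  -- Since N commutes with adding t, the class of `true` is the translate by (t , t) of the class of
  -- `false`; cancelling t reduces everything to the seeds.
  extra-compatible : ∀ {x y x′ y′ β} → Coloured x y (extra β) → Coloured x′ y′ (extra β) → Compatible x y x′ y′
  extra-compatible (extra {β} {e} (refl , refl)) (extra {e = e′} (refl , refl)) =
    (λ x≡x′ → proj₂ (conclude (seed-row-injective (rows β x≡x′)))) ,
    (λ y≡y′ → proj₁ (conclude (seed-col-injective (cols β y≡y′)))) ,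
    (λ xy≡xy′ → conclude (seed-sum-injective (sums β xy≡xy′)))
    where
    conclude : e ≡ e′ → row (kind e) (translate β (seed e)) ≡ row (kind e′) (translate β (seed e′))
                      × translate β (seed e) ⊕ gap e ≡ translate β (seed e′) ⊕ gap e′
    conclude refl = refl , refl
    row-⊕t : ∀ τ z → row τ (z ⊕ t) ≡ row τ z ⊕ t
    row-⊕t false z = refl
    row-⊕t true  z = N-⊕t z
    col-⊕t : ∀ e → (seed e ⊕ t) ⊕ gap e ≡ (seed e ⊕ gap e) ⊕ t
    col-⊕t e = ⊕-swapʳ (seed e) t (gap e)
    sum-⊕t : ∀ e → row (kind e) (seed e ⊕ t) ⊕ ((seed e ⊕ t) ⊕ gap e)
                 ≡ (row (kind e) (seed e) ⊕ (seed e ⊕ gap e)) ⊕ (t ⊕ t)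
    sum-⊕t e = trans (cong₂ _⊕_ (row-⊕t (kind e) (seed e)) (col-⊕t e)) (⊕-interchange _ _ _ _)
    rows : ∀ β → row (kind e) (translate β (seed e)) ≡ row (kind e′) (translate β (seed e′)) →
           row (kind e) (seed e) ≡ row (kind e′) (seed e′)
    rows false r = r
    rows true  r = ⊕-cancelʳ t _ _ (trans (sym (row-⊕t (kind e) (seed e))) (trans r (row-⊕t (kind e′) (seed e′))))
    cols : ∀ β → translate β (seed e) ⊕ gap e ≡ translate β (seed e′) ⊕ gap e′ →
           seed e ⊕ gap e ≡ seed e′ ⊕ gap e′
    cols false r = r
    cols true  r = ⊕-cancelʳ t _ _ (trans (sym (col-⊕t e)) (trans r (col-⊕t e′)))
    sums : ∀ β → row (kind e) (translate β (seed e)) ⊕ (translate β (seed e) ⊕ gap e)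
               ≡ row (kind e′) (translate β (seed e′)) ⊕ (translate β (seed e′) ⊕ gap e′) →
           row (kind e) (seed e) ⊕ (seed e ⊕ gap e) ≡ row (kind e′) (seed e′) ⊕ (seed e′ ⊕ gap e′)
    sums false r = r
    sums true  r = ⊕-cancelʳ (t ⊕ t) _ _ (trans (sym (sum-⊕t e)) (trans r (sum-⊕t e′)))

  compatible : ∀ {x y x′ y′} k → Coloured x y k → Coloured x′ y′ k → Compatible x y x′ y′
  compatible (regular _ _) = regular-compatible
  compatible (extra _)     = extra-compatible

  bit : Bool → Fin 2
  bit false = zero
  bit true  = suc zero

  bit-injective : ∀ {b b′} → bit b ≡ bit b′ → b ≡ b′
  bit-injective {false} {false} _ = refl
  bit-injective {true}  {true}  _ = refl

  regular≤n : μ * ζ * 2 ≤ n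
  regular≤n = subst (_≤ n) (trans size-C (*-comm 2 m)) (size≤n C)

  encode : Colour → Fin n ⊎ Fin 2
  encode (regular (j , z) σ) = inj₁ (Fin.inject≤ (Fin.combine (Fin.combine j z) (bit σ)) regular≤n)
  encode (extra β)           = inj₂ (bit β)

  encode-injective : ∀ k k′ → encode k ≡ encode k′ → k ≡ k′
  encode-injective (regular (j , z) σ) (regular (j′ , z′) σ′) e =
    cong₂ regular (cong₂ _,_ (proj₁ jz≡) (proj₂ jz≡)) (bit-injective (proj₂ jzσ≡))
    where
    jzσ≡ = Fin.combine-injective (Fin.combine j z) (bit σ) (Fin.combine j′ z′) (bit σ′)
             (Fin.inject≤-injective regular≤n regular≤n _ _ (inj₁-injective e))
    jz≡ = Fin.combine-injective j z j′ z′ (proj₁ jzσ≡)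
  encode-injective (extra β) (extra β′) e = cong extra (bit-injective (inj₂-injective e))

  code : Colour → Fin (n + 2)
  code k = Fin.join n 2 (encode k)

  code-injective : ∀ {k k′} → code k ≡ code k′ → k ≡ k′
  code-injective {k} {k′} e = encode-injective k k′ (trans (sym (Fin.splitAt-join n 2 (encode k)))
    (trans (cong (Fin.splitAt n) e) (Fin.splitAt-join n 2 (encode k′))))

  partition : PartitionIntoPT (cayley G) (n + 2)
  partition = (λ x y → code (proj₁ (colour x y))) , λ k {x} {y} {x′} {y′} eq eq′ →
    compatible (proj₁ (colour x y)) (proj₂ (colour x y))
      (subst (Coloured x′ y′) (sym (code-injective {proj₁ (colour x y)} {proj₁ (colour x′ y′)} (trans eq (sym eq′)))) (proj₂ (colour x′ y′)))

theorem2p3 : (n : ℕ) (G : FiniteAbelianGroup n) →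
    (∀ (P : Subset n) → FiniteAbelianGroup.IsSylow G 2 P →
    FiniteAbelianGroup.IsCyclic G P × FiniteAbelianGroup.IsNontrivial G P) →
    χ≤ (cayley G) (n + 2)
theorem2p3 n G sylow = Colouring.partition G involution (Frames.frame G involution)
  where
  involution : Involutions.UniqueInvolution G
  involution = Involutions.unique-involution G sylow
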